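{- Let $p\equiv 1\pmod 4$ be a prime. Let $X=\{(a,b)\in V\times V : a<b<\overline{a}<\overline{b}\}$, $Y=\{(a,b)\in V\times V : a<\overline{a}<b<\overline{b}\}$, $Z=\{(a,b)\in V\times V : a<b<\overline{b}<\overline{a}\}$. Then $|X|=|Y|=|Z|=(p-1)(p-5)/96$.
   Context: For an integer $x$, $\{x\}_p$ denotes the least nonnegative residue of $x$ modulo $p$, and $\widetilde{x}=p-\{x\}_p$ if $\{x\}_p>p/2$, while $\widetilde{x}=\{x\}_p$ if $\{x\}_p<p/2$. Let $t=\prod_{x=1}^{(p-1)/2}x$ (so $t^2\equiv-1\pmod p$). Let $V=\{x : 1\le x\le (p-1)/2,\ x<\widetilde{tx}\}$, and for $a\in V$ put $\overline{a}=\widetilde{ta}$; the pairs $(a,\overline{a})$, $a\in V$, partition $\{1,\ldots,(p-1)/2\}$. -}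

module Defs where

open import Data.Nat using (ℕ; zero; suc; _+_; _*_; _∸_; _<_; _<ᵇ_; NonZero)
open import Data.Nat.DivMod using (_/_; _%_)
open import Data.Nat.Properties using (_<?_)

open import Data.Bool using (Bool; if_then_else_)
open import Data.List using (List; []; _∷_; map; filter; length; concatMap)
open import Data.Nat.ListAction using (product)
open import Data.Product using (_×_; _,_; proj₁; proj₂)
open import Relation.Nullary.Decidable using (_×-dec_)

range1 : ℕ → List ℕ
range1 zero    = []
range1 (suc n) = range1 n Data.List.++ (suc n ∷ [])

module _ (p : ℕ) .{{_ : NonZero p}} where

  half : ℕ
  half = (p ∸ 1) / 2

  t : ℕ
  t = product (range1 half)

  res : ℕ → ℕ
  res x = x % p

  tilde : ℕ → ℕ
  tilde x = if p <ᵇ (2 * res x) then p ∸ res x else res x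

  bar : ℕ → ℕ
  bar a = tilde (t * a)

  V : List ℕ
  V = filter (λ x → x <? bar x) (range1 half)

  VV : List (ℕ × ℕ)
  VV = concatMap (λ a → map (λ b → (a , b)) V) V

  X : List (ℕ × ℕ)
  X = filter (λ ab → let a = proj₁ ab ; b = proj₂ ab in
               (a <? b) ×-dec ((b <? bar a) ×-dec (bar a <? bar b))) VV

  Y : List (ℕ × ℕ)
  Y = filter (λ ab → let a = proj₁ ab ; b = proj₂ ab in
               (a <? bar a) ×-dec ((bar a <? b) ×-dec (b <? bar b))) VV

  Z : List (ℕ × ℕ)
  Z = filter (λ ab → let a = proj₁ ab ; b = proj₂ ab in
               (a <? b) ×-dec ((b <? bar b) ×-dec (bar b <? bar a))) VV

{-# OPTIONS --safe #-}
-- Write p = 2M + 1 and M = 2k, so that k = |V|, and let ta = ±ā. The map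
-- (a, b) ↦ (|a − b|, tilde (a + b)) is a bijection of {(a, b) : 1 ≤ a < b ≤ M} onto itself: the
-- second component always exceeds the first, and the parity of their difference tells whether
-- a + b was reflected at p/2. Multiplication by t carries the image of (a, b) to the image of
-- (ā, b̄) up to order, the order being reversed exactly when the signs of ta and tb differ. Two
-- consequences:
--
--   * a ↦ ā reverses the order of k² pairs, since exactly one of the signs of ta, tā is −;
--   * a ↦ ā − a permutes V, so Σ ā = 2 Σ a over V and hence 3 Σ a = k(2k + 1).
--
-- Counting the relative positions of two pairs of V, the number of reversed pairs is
-- k + 2|X| + 4|Z| and Σ a = k + |X| + 2|Y| + |Z|, while k² = k + 2(|X| + |Y| + |Z|). These linear
-- equations give |X| = |Y| = |Z| = k(k − 1)/6.
module Submission where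

open import Defs
open import Data.Bool using (Bool; true; false; _∧_; not; if_then_else_; _xor_)
open import Data.Bool.Properties using (not-¬)
open import Data.Empty using (⊥; ⊥-elim)
open import Data.Integer as ℤ using (ℤ; +_; -_; 0ℤ; 1ℤ; -1ℤ)
import Data.Integer.Properties as ℤ
import Data.Integer.Tactic.RingSolver as ℤ-Solver
open import Data.List using (length; List; []; _∷_; _++_; map; filter; concatMap; cartesianProduct)
open import Data.List.Membership.Propositional using (_∈_)
open import Data.List.Membership.Propositional.Properties using (∈-map⁺; ∈-map⁻; ∈-++⁺ˡ; ∈-++⁺ʳ; ∈-++⁻; ∈-filter⁺; ∈-filter⁻; ∈-cartesianProduct⁺; ∈-cartesianProduct⁻)
open import Data.List.Membership.Propositional.Properties.WithK using (unique∧set⇒bag)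
open import Data.List.Properties using (map-++; length-++)
open import Data.List.Relation.Binary.BagAndSetEquality using (∼bag⇒↭)
open import Data.List.Relation.Binary.Permutation.Propositional using (_↭_)
open import Data.List.Relation.Binary.Permutation.Propositional.Properties using (map⁺)
import Data.List.Relation.Unary.All as All
open import Data.List.Relation.Unary.AllPairs using ([]; _∷_)
open import Data.List.Relation.Unary.Any using (here; there)
open import Data.List.Relation.Unary.Unique.Propositional using (Unique)
import Data.List.Relation.Unary.Unique.Propositional.Properties as Unique
open import Data.Nat using (ℕ; _∸_; _*_; _%_; _/_; NonZero; zero; suc; _+_; _≤_; _<_; _<ᵇ_; z≤n; s≤s; z<s; ∣_-_∣; nonTrivial⇒n>1)
open import Data.Nat.Coprimality using (coprime-Bézout; prime⇒coprime)
open import Data.Nat.DivMod using (m%n<n; m≡m%n+[m/n]*n; m*n/n≡m)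
open import Data.Nat.Divisibility using (_∣_; divides; ∣⇒≤)
open import Data.Nat.GCD using (module Bézout)
open import Data.Nat.ListAction using (sum; product)
open import Data.Nat.ListAction.Properties using (sum-↭; sum-++; product-↭; product-++)
open import Data.Nat.Primality using (Prime; euclidsLemma; prime⇒nonTrivial; ¬prime[1])
open import Data.Nat.Properties
import Data.Nat.Tactic.RingSolver as ℕ-Solver
open import Data.Product using (_×_; _,_; proj₁; proj₂; ∃; swap)
open import Data.Sum using (_⊎_; inj₁; inj₂)
open import Function using (_∘_; mk⇔)
open import Relation.Binary.Bundles using (Setoid)
open import Relation.Binary.Definitions using (tri<; tri≈; tri>)
open import Relation.Binary.PropositionalEquality using (_≡_; _≢_; refl; sym; trans; cong; cong₂; subst; module ≡-Reasoning)
import Relation.Binary.Reasoning.Setoid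
open import Relation.Nullary using (yes; no; does; ¬?)
open import Relation.Unary using (Decidable)

-- Permutations from bijections and from involutions.

private variable
  A B : Set

-- In a list without repetitions membership has at most one proof, so mutual inclusion of two such
-- lists already matches their elements with multiplicity.
set⇒↭ : {xs ys : List A} → Unique xs → Unique ys →
  (∀ {x} → x ∈ xs → x ∈ ys) → (∀ {x} → x ∈ ys → x ∈ xs) → xs ↭ ys
set⇒↭ u v xs⊆ys ys⊆xs = ∼bag⇒↭ (unique∧set⇒bag u v (mk⇔ xs⊆ys ys⊆xs))

map-unique : (f : A → B) {xs : List A} → (∀ {x y} → x ∈ xs → y ∈ xs → f x ≡ f y → x ≡ y) →
  Unique xs → Unique (map f xs)
map-unique f {[]}     inj []        = []
map-unique f {x ∷ xs} inj (x∉ ∷ u) =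
  All.tabulate (λ y∈ fx≡y → let (z , z∈ , y≡) = ∈-map⁻ f y∈ in
    All.lookup x∉ z∈ (inj (here refl) (there z∈) (trans fx≡y y≡)))
  ∷ map-unique f (λ p q → inj (there p) (there q)) u

bijection⇒↭ : (f : A → B) {xs : List A} {ys : List B} → Unique xs → Unique ys →
  (∀ {x} → x ∈ xs → f x ∈ ys) →
  (∀ {x y} → x ∈ xs → y ∈ xs → f x ≡ f y → x ≡ y) →
  (∀ {y} → y ∈ ys → ∃ λ x → x ∈ xs × f x ≡ y) →
  map f xs ↭ ys
bijection⇒↭ f u v into inj surj = set⇒↭ (map-unique f inj u) v
  (λ y∈ → let (x , x∈ , y≡) = ∈-map⁻ f y∈ in subst (_∈ _) (sym y≡) (into x∈))
  (λ y∈ → let (x , x∈ , ≡y) = surj y∈ in subst (_∈ _) ≡y (∈-map⁺ f x∈))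

-- Every orbit consists of two distinct elements x and ι x, and `vs` collects the smaller ones. This
-- serves twice: for inverses modulo p in Wilson's theorem and for the pairing of a with ā.
involution⇒↭ : (ι : ℕ → ℕ) {xs : List ℕ} → Unique xs →
  (∀ {x} → x ∈ xs → ι x ∈ xs) → (∀ {x} → x ∈ xs → ι (ι x) ≡ x) → (∀ {x} → x ∈ xs → ι x ≢ x) →
  let vs = filter (λ x → x <? ι x) xs in xs ↭ vs ++ map ι vs
involution⇒↭ ι {xs} u into invol free = set⇒↭ u
  (Unique.++⁺ (Unique.filter⁺ lt? u)
    (map-unique ι (λ x∈ y∈ eq → trans (sym (invol (∈xs x∈))) (trans (cong ι eq) (invol (∈xs y∈))))
      (Unique.filter⁺ lt? u))
    λ (x∈vs , x∈ιvs) → let (y , y∈ , x≡) = ∈-map⁻ ι x∈ιvs in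
      <-asym (lt y∈) (subst (ι y <_) (invol (∈xs y∈)) (subst (λ z → z < ι z) x≡ (lt x∈vs))))
  to from
  where
  lt? = λ x → x <? ι x
  vs = filter lt? xs
  ∈xs : ∀ {x} → x ∈ vs → x ∈ xs
  ∈xs x∈ = proj₁ (∈-filter⁻ lt? {xs = xs} x∈)
  lt : ∀ {x} → x ∈ vs → x < ι x
  lt x∈ = proj₂ (∈-filter⁻ lt? {xs = xs} x∈)
  to : ∀ {x} → x ∈ xs → x ∈ vs ++ map ι vs
  to {x} x∈ with <-cmp x (ι x)
  ... | tri< x<ιx _ _ = ∈-++⁺ˡ (∈-filter⁺ lt? x∈ x<ιx)
  ... | tri≈ _ x≡ιx _ = ⊥-elim (free x∈ (sym x≡ιx))
  ... | tri> _ _ ιx<x = ∈-++⁺ʳ vs (subst (_∈ map ι vs) (invol x∈)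
          (∈-map⁺ ι (∈-filter⁺ lt? (into x∈) (subst (ι x <_) (sym (invol x∈)) ιx<x))))
  from : ∀ {x} → x ∈ vs ++ map ι vs → x ∈ xs
  from x∈ with ∈-++⁻ vs x∈
  ... | inj₁ x∈vs  = ∈xs x∈vs
  ... | inj₂ x∈ιvs = let (y , y∈ , x≡) = ∈-map⁻ ι x∈ιvs in subst (_∈ xs) (sym x≡) (into (∈xs y∈))

-- Initial segments of the positive integers.

∈-range1⁺ : ∀ {n x} → 1 ≤ x → x ≤ n → x ∈ range1 n
∈-range1⁺ {zero}  {suc _} _ ()
∈-range1⁺ {suc n} 1≤x x≤1+n with m≤n⇒m<n∨m≡n x≤1+n
... | inj₁ (s≤s x≤n) = ∈-++⁺ˡ (∈-range1⁺ 1≤x x≤n)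
... | inj₂ refl      = ∈-++⁺ʳ (range1 n) (here refl)

∈-range1⁻ : ∀ {n x} → x ∈ range1 n → 1 ≤ x × x ≤ n
∈-range1⁻ {suc n} x∈ with ∈-++⁻ (range1 n) x∈
... | inj₁ x∈′         = let (1≤x , x≤n) = ∈-range1⁻ x∈′ in 1≤x , m≤n⇒m≤1+n x≤n
... | inj₂ (here refl) = z<s , ≤-refl

range1-unique : ∀ n → Unique (range1 n)
range1-unique zero    = []
range1-unique (suc n) = Unique.++⁺ (range1-unique n) (All.[] ∷ [])
  λ { (x∈ , here refl) → 1+n≰n (proj₂ (∈-range1⁻ x∈)) }

length-range1 : ∀ n → length (range1 n) ≡ n
length-range1 zero    = refl
length-range1 (suc n) = trans (length-++ (range1 n)) (trans (cong (_+ 1) (length-range1 n)) (+-comm n 1))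

-- Finite sums and double sums.

∑ : List A → (A → ℕ) → ℕ
∑ xs f = sum (map f xs)

𝟙 : Bool → ℕ
𝟙 b = if b then 1 else 0

∑-cong : (xs : List A) {f g : A → ℕ} → (∀ {x} → x ∈ xs → f x ≡ g x) → ∑ xs f ≡ ∑ xs g
∑-cong []       eq = refl
∑-cong (x ∷ xs) eq = cong₂ _+_ (eq (here refl)) (∑-cong xs (eq ∘ there))

∑-zero : (xs : List A) → ∑ xs (λ _ → 0) ≡ 0
∑-zero []       = refl
∑-zero (_ ∷ xs) = ∑-zero xs

∑-one : (xs : List A) → ∑ xs (λ _ → 1) ≡ length xs
∑-one []       = refl
∑-one (_ ∷ xs) = cong suc (∑-one xs)

∑-+ : (xs : List A) (f g : A → ℕ) → ∑ xs (λ x → f x + g x) ≡ ∑ xs f + ∑ xs g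
∑-+ []       f g = refl
∑-+ (x ∷ xs) f g = trans (cong (_+_ (f x + g x)) (∑-+ xs f g))
  (interchange (f x) (g x) (∑ xs f) (∑ xs g))
  where
  interchange : ∀ a b c d → a + b + (c + d) ≡ a + c + (b + d)
  interchange = ℕ-Solver.solve-∀

∑-*ʳ : (xs : List A) (f : A → ℕ) (c : ℕ) → ∑ xs (λ x → f x * c) ≡ ∑ xs f * c
∑-*ʳ []       f c = refl
∑-*ʳ (x ∷ xs) f c = trans (cong (_+_ (f x * c)) (∑-*ʳ xs f c)) (sym (*-distribʳ-+ c (f x) _))

∑-++ : (xs ys : List A) (f : A → ℕ) → ∑ (xs ++ ys) f ≡ ∑ xs f + ∑ ys f
∑-++ xs ys f = trans (cong sum (map-++ f xs ys)) (sum-++ (map f xs) (map f ys))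

∑-map : (g : A → B) (xs : List A) (f : B → ℕ) → ∑ (map g xs) f ≡ ∑ xs (f ∘ g)
∑-map g []       f = refl
∑-map g (x ∷ xs) f = cong (_+_ (f (g x))) (∑-map g xs f)

∑-↭ : {xs ys : List A} → xs ↭ ys → (f : A → ℕ) → ∑ xs f ≡ ∑ ys f
∑-↭ xs↭ys f = sum-↭ (map⁺ f xs↭ys)

∑-swap : (xs : List A) (ys : List B) (f : A → B → ℕ) →
  ∑ xs (λ x → ∑ ys (f x)) ≡ ∑ ys (λ y → ∑ xs (λ x → f x y))
∑-swap []       ys f = sym (∑-zero ys)
∑-swap (x ∷ xs) ys f = trans (cong (_+_ (∑ ys (f x))) (∑-swap xs ys f)) (sym (∑-+ ys (f x) _))

∑₂ : List A → (A → A → ℕ) → ℕ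
∑₂ xs f = ∑ xs (λ a → ∑ xs (f a))

∑₂-cong : (xs : List A) {f g : A → A → ℕ} → (∀ {a b} → a ∈ xs → b ∈ xs → f a b ≡ g a b) →
  ∑₂ xs f ≡ ∑₂ xs g
∑₂-cong xs eq = ∑-cong xs (λ a∈ → ∑-cong xs (λ b∈ → eq a∈ b∈))

∑₂-+ : (xs : List A) (f g : A → A → ℕ) → ∑₂ xs (λ a b → f a b + g a b) ≡ ∑₂ xs f + ∑₂ xs g
∑₂-+ xs f g = trans (∑-cong xs (λ {a} _ → ∑-+ xs (f a) (g a))) (∑-+ xs _ _)

∑₂-sym : (xs : List A) (f : A → A → ℕ) → ∑₂ xs (λ a b → f a b + f b a) ≡ ∑₂ xs f + ∑₂ xs f
∑₂-sym xs f = trans (∑₂-+ xs f (λ a b → f b a)) (cong (_+_ (∑₂ xs f)) (∑-swap xs xs (λ a b → f b a)))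

∑-filter : {P : A → Set} (P? : Decidable P) (xs : List A) (f : A → ℕ) →
  ∑ (filter P? xs) f ≡ ∑ xs (λ x → if does (P? x) then f x else 0)
∑-filter P? []       f = refl
∑-filter P? (x ∷ xs) f with does (P? x)
... | true  = cong (_+_ (f x)) (∑-filter P? xs f)
... | false = ∑-filter P? xs f

-- This has the shape in which `VV` is built; `∑-cartesianProduct` is its counterpart for the pairs
-- taken from {1, ..., M}.
∑-pairs : (xs : List A) (ys : List B) (f : A × B → ℕ) →
  ∑ (concatMap (λ a → map (a ,_) ys) xs) f ≡ ∑ xs (λ a → ∑ ys (λ b → f (a , b)))
∑-pairs []       ys f = refl
∑-pairs (x ∷ xs) ys f = trans (∑-++ (map (x ,_) ys) _ f)
  (cong₂ _+_ (∑-map (x ,_) ys f) (∑-pairs xs ys f))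

∑-cartesianProduct : (xs : List A) (ys : List B) (f : A × B → ℕ) →
  ∑ (cartesianProduct xs ys) f ≡ ∑ xs (λ a → ∑ ys (λ b → f (a , b)))
∑-cartesianProduct []       ys f = refl
∑-cartesianProduct (x ∷ xs) ys f = trans (∑-++ (map (x ,_) ys) _ f)
  (cong₂ _+_ (∑-map (x ,_) ys f) (∑-cartesianProduct xs ys f))

length-filter-pairs : {P : A × B → Set} (P? : Decidable P) (xs : List A) (ys : List B) →
  length (filter P? (concatMap (λ a → map (a ,_) ys) xs))
    ≡ ∑ xs (λ a → ∑ ys (λ b → 𝟙 (does (P? (a , b)))))
length-filter-pairs P? xs ys = trans (sym (∑-one (filter P? pairs)))
  (trans (∑-filter P? pairs (λ _ → 1)) (∑-pairs xs ys _))
  where pairs = concatMap (λ a → map (a ,_) ys) xs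

-- Boolean comparison and counting by indicators.

<⇒<ᵇ≡true : ∀ {m n} → m < n → (m <ᵇ n) ≡ true
<⇒<ᵇ≡true {zero}  {suc n} _         = refl
<⇒<ᵇ≡true {suc m} {suc n} (s≤s m<n) = <⇒<ᵇ≡true m<n

≥⇒<ᵇ≡false : ∀ {m n} → n ≤ m → (m <ᵇ n) ≡ false
≥⇒<ᵇ≡false {m}     {zero}  _         = refl
≥⇒<ᵇ≡false {suc m} {suc n} (s≤s n≤m) = ≥⇒<ᵇ≡false n≤m

<⇒>ᵇ≡false : ∀ {m n} → m < n → (n <ᵇ m) ≡ false
<⇒>ᵇ≡false m<n = ≥⇒<ᵇ≡false (<⇒≤ m<n)

-- Equality is spelled out by comparisons so that rewriting the values of `_<ᵇ_`, as
-- `pair-identities` does, evaluates it along with the other indicators.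
_==_ : ℕ → ℕ → Bool
a == b = not (a <ᵇ b) ∧ not (b <ᵇ a)

==-refl : ∀ a → (a == a) ≡ true
==-refl a rewrite ≥⇒<ᵇ≡false (≤-refl {a}) = refl

≢⇒==-false : ∀ {a b} → a ≢ b → (a == b) ≡ false
≢⇒==-false {a} {b} a≢b with <-cmp a b
... | tri< a<b _ _ rewrite <⇒<ᵇ≡true a<b = refl
... | tri≈ _ a≡b _ = ⊥-elim (a≢b a≡b)
... | tri> _ _ b<a rewrite <⇒<ᵇ≡true b<a | ≥⇒<ᵇ≡false (<⇒≤ b<a) = refl

∑-diagonal : {xs : List ℕ} → Unique xs → ∀ {a} → a ∈ xs → ∑ xs (λ b → 𝟙 (a == b)) ≡ 1
∑-diagonal {a ∷ xs} (a∉ ∷ u) (here refl) rewrite ==-refl a = cong suc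
  (trans (∑-cong xs (λ b∈ → cong 𝟙 (≢⇒==-false (All.lookup a∉ b∈)))) (∑-zero xs))
∑-diagonal {x ∷ xs} (x∉ ∷ u) {a} (there a∈)
  rewrite ≢⇒==-false {a} {x} (λ a≡x → All.lookup x∉ a∈ (sym a≡x)) = ∑-diagonal u a∈

∑-range1-below : ∀ {n a} → n ≤ a → ∑ (range1 n) (λ y → 𝟙 (not (a <ᵇ y))) ≡ n
∑-range1-below {zero}      _   = refl
∑-range1-below {suc n} {a} n<a = trans (∑-++ (range1 n) (suc n ∷ []) _) (trans
  (cong₂ (λ s b → s + (𝟙 (not b) + 0)) (∑-range1-below (<⇒≤ n<a)) (≥⇒<ᵇ≡false n<a))
  (+-comm n 1))

-- This lets the sum of the elements of V be treated as a count of positions: `count-below` replaces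
-- each a by the points that do not exceed it.
∑-range1-initial : ∀ {n a} → a ≤ n → ∑ (range1 n) (λ y → 𝟙 (not (a <ᵇ y))) ≡ a
∑-range1-initial {n}     {a} a≤n with m≤n⇒m<n∨m≡n a≤n
∑-range1-initial {n}     {a} a≤n | inj₂ refl      = ∑-range1-below {n} ≤-refl
∑-range1-initial {suc n} {a} a≤n | inj₁ (s≤s a≤n′) = trans (∑-++ (range1 n) (suc n ∷ []) _) (trans
  (cong₂ (λ s b → s + (𝟙 (not b) + 0)) (∑-range1-initial a≤n′) (<⇒<ᵇ≡true (s≤s a≤n′)))
  (+-identityʳ a))

∑-range1-id : ∀ n → ∑ (range1 n) (λ x → x) * 2 ≡ n * suc n
∑-range1-id zero    = refl
∑-range1-id (suc n) = begin
  ∑ (range1 n ++ suc n ∷ []) (λ x → x) * 2      ≡⟨ cong (_* 2) (∑-++ (range1 n) (suc n ∷ []) (λ x → x)) ⟩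
  (∑ (range1 n) (λ x → x) + (suc n + 0)) * 2    ≡⟨ *-distribʳ-+ 2 (∑ (range1 n) (λ x → x)) (suc n + 0) ⟩
  ∑ (range1 n) (λ x → x) * 2 + (suc n + 0) * 2  ≡⟨ cong (_+ (suc n + 0) * 2) (∑-range1-id n) ⟩
  n * suc n + (suc n + 0) * 2                   ≡⟨ lem n ⟩
  suc n * suc (suc n)                           ∎
  where
  open ≡-Reasoning
  lem : ∀ n → n * suc n + (suc n + 0) * 2 ≡ suc n * suc (suc n)
  lem = ℕ-Solver.solve-∀

-- Congruence modulo p, and congruence up to sign.

module Congruence (p : ℕ) where

  infix 4 _≈_ _≈±_

  -- An explicit quotient and an equation solved for x allow matching on `refl`, after which the
  -- closure properties are polynomial identities for the ring solver.
  record _≈_ (x y : ℤ) : Set where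
    constructor ≈-by
    field
      quotient : ℤ
      equality : x ≡ y ℤ.+ quotient ℤ.* + p

  ≡⇒≈ : ∀ {x y} → x ≡ y → x ≈ y
  ≡⇒≈ {x} refl = ≈-by 0ℤ (lem x (+ p))
    where
    lem : ∀ x p → x ≡ x ℤ.+ 0ℤ ℤ.* p
    lem = ℤ-Solver.solve-∀

  ≈-refl : ∀ {x} → x ≈ x
  ≈-refl = ≡⇒≈ refl

  ≈-sym : ∀ {x y} → x ≈ y → y ≈ x
  ≈-sym {x} {y} (≈-by q refl) = ≈-by (- q) (lem y q (+ p))
    where
    lem : ∀ y q p → y ≡ y ℤ.+ q ℤ.* p ℤ.+ (- q) ℤ.* p
    lem = ℤ-Solver.solve-∀

  ≈-trans : ∀ {x y z} → x ≈ y → y ≈ z → x ≈ z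
  ≈-trans {z = z} (≈-by q refl) (≈-by r refl) = ≈-by (q ℤ.+ r) (lem z q r (+ p))
    where
    lem : ∀ z q r p → z ℤ.+ r ℤ.* p ℤ.+ q ℤ.* p ≡ z ℤ.+ (q ℤ.+ r) ℤ.* p
    lem = ℤ-Solver.solve-∀

  ≈-setoid : Setoid _ _
  ≈-setoid = record
    { Carrier = ℤ ; _≈_ = _≈_
    ; isEquivalence = record { refl = ≈-refl ; sym = ≈-sym ; trans = ≈-trans } }

  +-cong : ∀ {x y u v} → x ≈ y → u ≈ v → x ℤ.+ u ≈ y ℤ.+ v
  +-cong {y = y} {v = v} (≈-by q refl) (≈-by r refl) = ≈-by (q ℤ.+ r) (lem y v q r (+ p))
    where
    lem : ∀ y v q r p → y ℤ.+ q ℤ.* p ℤ.+ (v ℤ.+ r ℤ.* p) ≡ y ℤ.+ v ℤ.+ (q ℤ.+ r) ℤ.* p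
    lem = ℤ-Solver.solve-∀

  *-cong : ∀ {x y u v} → x ≈ y → u ≈ v → x ℤ.* u ≈ y ℤ.* v
  *-cong {y = y} {v = v} (≈-by q refl) (≈-by r refl) =
    ≈-by (y ℤ.* r ℤ.+ v ℤ.* q ℤ.+ q ℤ.* r ℤ.* + p) (lem y v q r (+ p))
    where
    lem : ∀ y v q r p → (y ℤ.+ q ℤ.* p) ℤ.* (v ℤ.+ r ℤ.* p)
      ≡ y ℤ.* v ℤ.+ (y ℤ.* r ℤ.+ v ℤ.* q ℤ.+ q ℤ.* r ℤ.* p) ℤ.* p
    lem = ℤ-Solver.solve-∀

  neg-cong : ∀ {x y} → x ≈ y → - x ≈ - y
  neg-cong {y = y} (≈-by q refl) = ≈-by (- q) (lem y q (+ p))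
    where
    lem : ∀ y q p → - (y ℤ.+ q ℤ.* p) ≡ - y ℤ.+ (- q) ℤ.* p
    lem = ℤ-Solver.solve-∀

  *-congˡ : ∀ z {x y} → x ≈ y → z ℤ.* x ≈ z ℤ.* y
  *-congˡ z = *-cong (≈-refl {z})

  *-congʳ : ∀ z {x y} → x ≈ y → x ℤ.* z ≈ y ℤ.* z
  *-congʳ z x≈y = *-cong x≈y (≈-refl {z})

  p≈0 : + p ≈ 0ℤ
  p≈0 = ≈-by 1ℤ (lem (+ p))
    where
    lem : ∀ p → p ≡ 0ℤ ℤ.+ 1ℤ ℤ.* p
    lem = ℤ-Solver.solve-∀

  ≈-difference : ∀ {x y} → x ≈ y → x ℤ.- y ≈ 0ℤ
  ≈-difference {y = y} (≈-by q refl) = ≈-by q (lem y q (+ p))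
    where
    lem : ∀ y q p → y ℤ.+ q ℤ.* p ℤ.- y ≡ 0ℤ ℤ.+ q ℤ.* p
    lem = ℤ-Solver.solve-∀

  ≈0⇒∣ : ∀ {x} → x ≈ 0ℤ → p ∣ ℤ.∣ x ∣
  ≈0⇒∣ {x} (≈-by q x≡) = divides ℤ.∣ q ∣
    (trans (cong ℤ.∣_∣ (trans x≡ (ℤ.+-identityˡ (q ℤ.* + p)))) (ℤ.abs-* q (+ p)))

  ≈0⇒≡0 : ∀ {n} → n < p → + n ≈ 0ℤ → n ≡ 0
  ≈0⇒≡0 {zero}  _   _   = refl
  ≈0⇒≡0 {suc n} n<p n≈0 = ⊥-elim (<⇒≱ n<p (∣⇒≤ (≈0⇒∣ n≈0)))

  pos-∸ : ∀ {m n} → n ≤ m → + (m ∸ n) ≡ + m ℤ.- + n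
  pos-∸ {m} {n} n≤m = trans (sym (ℤ.⊖-≥ n≤m)) (sym (ℤ.m-n≡m⊖n m n))

  ∣-∣-≤ : ∀ {m n} → n ≤ m → ∣ m - n ∣ ≡ m ∸ n
  ∣-∣-≤ {m} {n} n≤m = trans (∣-∣-comm m n) (m≤n⇒∣m-n∣≡n∸m n≤m)

  -- The relation whose classes `tilde` represents: reflection at p/2 discards the sign of a
  -- residue.
  _≈±_ : ℤ → ℤ → Set
  x ≈± y = x ≈ y ⊎ x ≈ - y

  private
    neg-neg : ∀ {x y} → x ≈ - y → - x ≈ y
    neg-neg x≈-y = ≈-trans (neg-cong x≈-y) (≡⇒≈ (ℤ.neg-involutive _))

  ≈±-sym : ∀ {x y} → x ≈± y → y ≈± x
  ≈±-sym (inj₁ x≈y)  = inj₁ (≈-sym x≈y)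
  ≈±-sym (inj₂ x≈-y) = inj₂ (≈-sym (neg-neg x≈-y))

  ≈±-trans : ∀ {x y z} → x ≈± y → y ≈± z → x ≈± z
  ≈±-trans (inj₁ e) (inj₁ f) = inj₁ (≈-trans e f)
  ≈±-trans (inj₁ e) (inj₂ f) = inj₂ (≈-trans e f)
  ≈±-trans (inj₂ e) (inj₁ f) = inj₂ (≈-trans e (neg-cong f))
  ≈±-trans (inj₂ e) (inj₂ f) = inj₁ (≈-trans e (neg-neg f))

  ≈±-*-congˡ : ∀ z {x y} → x ≈± y → z ℤ.* x ≈± z ℤ.* y
  ≈±-*-congˡ z (inj₁ e) = inj₁ (*-congˡ z e)
  ≈±-*-congˡ z (inj₂ e) = inj₂ (≈-trans (*-congˡ z e) (≡⇒≈ (sym (ℤ.neg-distribʳ-* z _))))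

  ∣-∣≈± : ∀ m n → + ∣ m - n ∣ ≈± + m ℤ.- + n
  ∣-∣≈± m n with ≤-total n m
  ... | inj₁ n≤m = inj₁ (≡⇒≈ (trans (cong +_ (∣-∣-≤ n≤m)) (pos-∸ n≤m)))
  ... | inj₂ m≤n = inj₂ (≡⇒≈ (trans (cong +_ (m≤n⇒∣m-n∣≡n∸m m≤n)) (trans (pos-∸ m≤n) (lem (+ m) (+ n)))))
    where
    lem : ∀ m n → n ℤ.- m ≡ - (m ℤ.- n)
    lem = ℤ-Solver.solve-∀

  ≈⇒≡ : ∀ {m n} → m < p → n < p → + m ≈ + n → m ≡ n
  ≈⇒≡ {m} {n} m<p n<p m≈n = ∣m-n∣≡0⇒m≡n (≈0⇒≡0
    (≤-<-trans (∣m-n∣≤m⊔n m n) (⊔-lub m<p n<p))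
    (lem (∣-∣≈± m n)))
    where
    lem : + ∣ m - n ∣ ≈± + m ℤ.- + n → + ∣ m - n ∣ ≈ 0ℤ
    lem (inj₁ e) = ≈-trans e (≈-difference m≈n)
    lem (inj₂ e) = ≈-trans e (neg-cong (≈-difference m≈n))

  -- With the minus sign, m + n is a multiple of p smaller than p, hence zero, and then m = n = 0.
  ≈±⇒≡ : ∀ {m n} → m < p → n < p → m + n < p → + m ≈± + n → m ≡ n
  ≈±⇒≡         m<p n<p _     (inj₁ e) = ≈⇒≡ m<p n<p e
  ≈±⇒≡ {m} {n} _   _   m+n<p (inj₂ e) = trans (m+n≡0⇒m≡0 m m+n≡0) (sym (m+n≡0⇒n≡0 m m+n≡0))
    where
    m+n≡0 : m + n ≡ 0
    m+n≡0 = ≈0⇒≡0 m+n<p (≈-trans (+-cong e (≈-refl {+ n})) (≡⇒≈ (ℤ.+-inverseˡ (+ n))))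

  p∸-≈ : ∀ {n} → n ≤ p → + (p ∸ n) ≈ - + n
  p∸-≈ {n} n≤p = ≈-trans (≡⇒≈ (pos-∸ n≤p)) (≈-trans (+-cong p≈0 (≈-refl { - + n})) (≡⇒≈ (ℤ.+-identityˡ _)))

  %-≈ : .{{_ : NonZero p}} → ∀ n → + n ≈ + (n % p)
  %-≈ n = ≈-by (+ (n / p))
    (trans (cong +_ (m≡m%n+[m/n]*n n p)) (cong (λ z → + (n % p) ℤ.+ z) (ℤ.pos-* (n / p) p)))

-- Wilson's theorem.

module Wilson (n : ℕ) (pr : Prime (suc n)) where

  private p = suc n
  open Congruence p
  open Relation.Binary.Reasoning.Setoid ≈-setoid

  1≤n : 1 ≤ n
  1≤n = ≤-pred (nonTrivial⇒n>1 p {{prime⇒nonTrivial pr}})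

  n≈-1 : + n ≈ -1ℤ
  n≈-1 = p∸-≈ {1} (s≤s z≤n)

  -- The range conditions stand inside the existential so that `inv` is a function on all of ℕ;
  -- outside {1, ..., n} it takes the default value 0.
  inverse-exists : ∀ x → ∃ λ y → 1 ≤ x → x ≤ n → y ≤ n × + x ℤ.* + y ≈ 1ℤ
  inverse-exists zero    = 0 , λ ()
  inverse-exists (suc m) with suc m ≤? n
  ... | no  x≰n = 0 , λ _ x≤n → ⊥-elim (x≰n x≤n)
  ... | yes x≤n with coprime-Bézout (prime⇒coprime {n = suc m} pr (s≤s x≤n))
  -- Here 1 + yx = up for x = m + 1, so the inverse of x is -y, represented by yn because n ≡ -1.
  ... | Bézout.+- u y eq = (y * n) % p , λ _ _ → ≤-pred (m%n<n (y * n) p) , (begin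
        + suc m ℤ.* + ((y * n) % p)   ≈⟨ *-congˡ (+ suc m) (≈-sym (%-≈ (y * n))) ⟩
        + suc m ℤ.* + (y * n)         ≡⟨ cong (λ z → + suc m ℤ.* z) (ℤ.pos-* y n) ⟩
        + suc m ℤ.* (+ y ℤ.* + n)     ≈⟨ *-congˡ (+ suc m) (*-congˡ (+ y) n≈-1) ⟩
        + suc m ℤ.* (+ y ℤ.* -1ℤ)     ≡⟨ lem (+ suc m) (+ y) ⟩
        1ℤ ℤ.- (1ℤ ℤ.+ + y ℤ.* + suc m) ≡⟨ cong (λ z → 1ℤ ℤ.- z) (trans (cong (λ z → 1ℤ ℤ.+ z) (sym (ℤ.pos-* y (suc m)))) (trans (cong +_ eq) (ℤ.pos-* u p))) ⟩
        1ℤ ℤ.- + u ℤ.* + p            ≈⟨ +-cong (≈-refl {1ℤ}) (neg-cong (*-congˡ (+ u) p≈0)) ⟩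
        1ℤ ℤ.- + u ℤ.* 0ℤ             ≡⟨ cong (λ z → 1ℤ ℤ.- z) (ℤ.*-zeroʳ (+ u)) ⟩
        1ℤ                            ∎)
    where
    lem : ∀ x y → x ℤ.* (y ℤ.* -1ℤ) ≡ 1ℤ ℤ.- (1ℤ ℤ.+ y ℤ.* x)
    lem = ℤ-Solver.solve-∀
  ... | Bézout.-+ u y eq = y % p , λ _ _ → ≤-pred (m%n<n y p) , (begin
        + suc m ℤ.* + (y % p)         ≈⟨ *-congˡ (+ suc m) (≈-sym (%-≈ y)) ⟩
        + suc m ℤ.* + y               ≡⟨ ℤ.*-comm (+ suc m) (+ y) ⟩
        + y ℤ.* + suc m               ≡⟨ sym (ℤ.pos-* y (suc m)) ⟩
        + (y * suc m)                 ≡⟨ cong +_ (sym eq) ⟩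
        1ℤ ℤ.+ + (u * p)              ≡⟨ cong (λ z → 1ℤ ℤ.+ z) (ℤ.pos-* u p) ⟩
        1ℤ ℤ.+ + u ℤ.* + p            ≈⟨ +-cong (≈-refl {1ℤ}) (*-congˡ (+ u) p≈0) ⟩
        1ℤ ℤ.+ + u ℤ.* 0ℤ             ≡⟨ cong (λ z → 1ℤ ℤ.+ z) (ℤ.*-zeroʳ (+ u)) ⟩
        1ℤ                            ∎)

  inv : ℕ → ℕ
  inv x = proj₁ (inverse-exists x)

  units : List ℕ
  units = range1 n

  *-inv : ∀ {x} → x ∈ units → + x ℤ.* + inv x ≈ 1ℤ
  *-inv {x} x∈ = let (1≤x , x≤n) = ∈-range1⁻ x∈ in proj₂ (proj₂ (inverse-exists x) 1≤x x≤n)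

  inv-∈ : ∀ {x} → x ∈ units → inv x ∈ units
  inv-∈ {x} x∈ = ∈-range1⁺ (n≢0⇒n>0 inv≢0) (proj₁ (proj₂ (inverse-exists x) 1≤x x≤n))
    where
    1≤x = proj₁ (∈-range1⁻ {n} x∈)
    x≤n = proj₂ (∈-range1⁻ x∈)
    inv≢0 : inv x ≢ 0
    inv≢0 eq with () ← ≈⇒≡ {1} {0} (s≤s 1≤n) z<s (begin
      1ℤ               ≈⟨ *-inv x∈ ⟨
      + x ℤ.* + inv x  ≡⟨ cong (λ y → + x ℤ.* + y) eq ⟩
      + x ℤ.* 0ℤ       ≡⟨ ℤ.*-zeroʳ (+ x) ⟩
      0ℤ               ∎)

  inv-involutive : ∀ {x} → x ∈ units → inv (inv x) ≡ x
  inv-involutive {x} x∈ = ≈⇒≡ (bound (inv-∈ (inv-∈ x∈))) (bound x∈) (begin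
    z                  ≡⟨ ℤ.*-identityˡ z ⟨
    1ℤ ℤ.* z           ≈⟨ *-congʳ z (*-inv x∈) ⟨
    + x ℤ.* y ℤ.* z    ≡⟨ ℤ.*-assoc (+ x) y z ⟩
    + x ℤ.* (y ℤ.* z)  ≈⟨ *-congˡ (+ x) (*-inv (inv-∈ x∈)) ⟩
    + x ℤ.* 1ℤ         ≡⟨ ℤ.*-identityʳ (+ x) ⟩
    + x                ∎)
    where
    y = + inv x
    z = + inv (inv x)
    bound : ∀ {y} → y ∈ units → y < p
    bound y∈ = s≤s (proj₂ (∈-range1⁻ y∈))

  -- If x is its own inverse, p divides x² - 1. For x = m + 1 this is m(m + 2), and by Euclid's
  -- lemma p divides a factor: the first is less than p and so must vanish, the second is at most p
  -- and so equals p.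
  self-inverse : ∀ {x} → x ∈ units → inv x ≡ x → x ≡ 1 ⊎ x ≡ n
  self-inverse {zero}  x∈ _ with () ← proj₁ (∈-range1⁻ {n} x∈)
  self-inverse {suc m} x∈ eq with euclidsLemma m (2 + m) pr (subst (p ∣_) ∣∣≡ (≈0⇒∣ (≈-difference x²≈1)))
    where
    x²≈1 : + suc m ℤ.* + suc m ≈ 1ℤ
    x²≈1 = subst (λ y → + suc m ℤ.* + y ≈ 1ℤ) eq (*-inv x∈)
    lem : ∀ m → (1ℤ ℤ.+ m) ℤ.* (1ℤ ℤ.+ m) ℤ.- 1ℤ ≡ m ℤ.* ((1ℤ ℤ.+ 1ℤ) ℤ.+ m)
    lem = ℤ-Solver.solve-∀
    ∣∣≡ : ℤ.∣ + suc m ℤ.* + suc m ℤ.- 1ℤ ∣ ≡ m * (2 + m)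
    ∣∣≡ = trans (cong ℤ.∣_∣ (lem (+ m))) (ℤ.abs-* (+ m) (+ (2 + m)))
  ... | inj₁ p∣m   with m
  ...   | zero   = inj₁ refl
  ...   | suc m′ = ⊥-elim (<⇒≱ (m≤n⇒m≤1+n (proj₂ (∈-range1⁻ x∈))) (∣⇒≤ p∣m))
  self-inverse {suc m} x∈ eq | inj₂ p∣2+m =
    inj₂ (≤-antisym (proj₂ (∈-range1⁻ x∈)) (≤-pred (∣⇒≤ p∣2+m)))

  1-self-inverse : inv 1 ≡ 1
  1-self-inverse = ≈⇒≡ (s≤s (proj₂ (∈-range1⁻ (inv-∈ 1∈)))) (s≤s 1≤n)
    (≈-trans (≡⇒≈ (sym (ℤ.*-identityˡ (+ inv 1)))) (*-inv 1∈))
    where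
    1∈ : 1 ∈ units
    1∈ = ∈-range1⁺ ≤-refl 1≤n

  n-self-inverse : inv n ≡ n
  n-self-inverse = ≈⇒≡ (s≤s (proj₂ (∈-range1⁻ (inv-∈ n∈)))) ≤-refl (begin
    + inv n                   ≡⟨ lem (+ inv n) ⟩
    - (-1ℤ ℤ.* + inv n)       ≈⟨ neg-cong (*-congʳ (+ inv n) n≈-1) ⟨
    - (+ n ℤ.* + inv n)       ≈⟨ neg-cong (*-inv n∈) ⟩
    -1ℤ                       ≈⟨ n≈-1 ⟨
    + n                       ∎)
    where
    n∈ : n ∈ units
    n∈ = ∈-range1⁺ 1≤n ≤-refl
    lem : ∀ y → y ≡ - (-1ℤ ℤ.* y)
    lem = ℤ-Solver.solve-∀

  product-inverse-pairs : ∀ xs → (∀ {x} → x ∈ xs → x ∈ units) → + product (xs ++ map inv xs) ≈ 1ℤ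
  product-inverse-pairs xs ⊆units = ≈-trans
    (≡⇒≈ (trans (cong +_ (product-++ xs (map inv xs))) (ℤ.pos-* (product xs) _))) (go xs ⊆units)
    where
    lem : ∀ x P y Q → (x ℤ.* P) ℤ.* (y ℤ.* Q) ≡ (x ℤ.* y) ℤ.* (P ℤ.* Q)
    lem = ℤ-Solver.solve-∀
    go : ∀ xs → (∀ {x} → x ∈ xs → x ∈ units) → + product xs ℤ.* + product (map inv xs) ≈ 1ℤ
    go []       _      = ≈-refl
    go (x ∷ xs) ⊆units = begin
      + (x * product xs) ℤ.* + (inv x * product (map inv xs))
        ≡⟨ cong₂ ℤ._*_ (ℤ.pos-* x (product xs)) (ℤ.pos-* (inv x) _) ⟩
      (+ x ℤ.* + product xs) ℤ.* (+ inv x ℤ.* + product (map inv xs))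
        ≡⟨ lem (+ x) (+ product xs) (+ inv x) _ ⟩
      (+ x ℤ.* + inv x) ℤ.* (+ product xs ℤ.* + product (map inv xs))
        ≈⟨ *-cong (*-inv (⊆units (here refl))) (go xs (⊆units ∘ there)) ⟩
      1ℤ ∎

  -- The units other than 1 and n fall into pairs {x, inv x} with product 1, which leaves 1 · n ≡
  -- -1. The condition `1 ≢ n` excludes p = 2, where the two self-inverse units would coincide.
  wilson : 1 ≢ n → + product (range1 n) ≈ -1ℤ
  wilson 1≢n = begin
    + product units                          ≡⟨ cong +_ (product-↭ units↭) ⟩
    + (1 * (n * product others))             ≡⟨ cong +_ (*-identityˡ (n * product others)) ⟩
    + (n * product others)                   ≡⟨ ℤ.pos-* n (product others) ⟩
    + n ℤ.* + product others                 ≡⟨ cong (λ P → + n ℤ.* + P) (product-↭ others↭) ⟩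
    + n ℤ.* + product (vs ++ map inv vs)     ≈⟨ *-cong n≈-1 (product-inverse-pairs vs
                                                  (λ x∈ → others⊆ (proj₁ (∈-filter⁻ (λ x → x <? inv x) {xs = others} x∈)))) ⟩
    -1ℤ                                      ∎
    where
    moved? = λ x → ¬? (inv x ≟ x)
    others = filter moved? units
    vs = filter (λ x → x <? inv x) others
    others⊆ : ∀ {x} → x ∈ others → x ∈ units
    others⊆ x∈ = proj₁ (∈-filter⁻ moved? {xs = units} x∈)
    moved : ∀ {x} → x ∈ others → inv x ≢ x
    moved x∈ = proj₂ (∈-filter⁻ moved? {xs = units} x∈)
    others-unique : Unique others
    others-unique = Unique.filter⁺ moved? (range1-unique n)
    others↭ : others ↭ vs ++ map inv vs
    others↭ = involution⇒↭ inv others-unique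
      (λ x∈ → ∈-filter⁺ moved? (inv-∈ (others⊆ x∈))
        (λ eq → moved x∈ (trans (sym eq) (inv-involutive (others⊆ x∈)))))
      (inv-involutive ∘ others⊆) moved
    to : ∀ {x} → x ∈ units → x ∈ 1 ∷ n ∷ others
    to {x} x∈ with inv x ≟ x
    ... | no  ≢x = there (there (∈-filter⁺ moved? x∈ ≢x))
    ... | yes ≡x with self-inverse x∈ ≡x
    ...   | inj₁ refl = here refl
    ...   | inj₂ refl = there (here refl)
    from : ∀ {x} → x ∈ 1 ∷ n ∷ others → x ∈ units
    from (here refl)         = ∈-range1⁺ ≤-refl 1≤n
    from (there (here refl)) = ∈-range1⁺ 1≤n ≤-refl
    from (there (there x∈))  = others⊆ x∈
    units↭ : units ↭ 1 ∷ n ∷ others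
    units↭ = set⇒↭ (range1-unique n)
      ((1≢n All.∷ All.tabulate (λ x∈ 1≡x → moved x∈ (subst (λ x → inv x ≡ x) 1≡x 1-self-inverse)))
       ∷ All.tabulate (λ x∈ n≡x → moved x∈ (subst (λ x → inv x ≡ x) n≡x n-self-inverse))
       ∷ others-unique)
      to from

-- The square of ((p - 1)/2)!.

module HalfFactorial (k : ℕ) (pr : Prime (suc ((k + k) + (k + k)))) where

  private
    M = k + k
    p = suc (M + M)
  open Congruence p
  open Relation.Binary.Reasoning.Setoid ≈-setoid

  product-negated : ∀ xs → (∀ {x} → x ∈ xs → x ≤ p) →
    + product (map (p ∸_) xs) ≈ (-1ℤ ℤ.^ length xs) ℤ.* + product xs
  product-negated []       _  = ≈-refl
  product-negated (x ∷ xs) ≤p = begin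
    + ((p ∸ x) * product (map (p ∸_) xs))       ≡⟨ ℤ.pos-* (p ∸ x) _ ⟩
    + (p ∸ x) ℤ.* + product (map (p ∸_) xs)     ≈⟨ *-cong (p∸-≈ (≤p (here refl))) (product-negated xs (≤p ∘ there)) ⟩
    - + x ℤ.* (s ℤ.* + product xs)              ≡⟨ lem (+ x) s (+ product xs) ⟩
    -1ℤ ℤ.* s ℤ.* (+ x ℤ.* + product xs)        ≡⟨ cong (-1ℤ ℤ.* s ℤ.*_) (ℤ.pos-* x (product xs)) ⟨
    -1ℤ ℤ.* s ℤ.* + (x * product xs)            ∎
    where
    s = -1ℤ ℤ.^ length xs
    lem : ∀ x s P → - x ℤ.* (s ℤ.* P) ≡ -1ℤ ℤ.* s ℤ.* (x ℤ.* P)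
    lem = ℤ-Solver.solve-∀

  -1^[k+k] : ∀ k → -1ℤ ℤ.^ (k + k) ≡ 1ℤ
  -1^[k+k] zero    = refl
  -1^[k+k] (suc k) rewrite +-suc k k | -1^[k+k] k = refl

  units↭ : range1 (M + M) ↭ range1 M ++ map (p ∸_) (range1 M)
  units↭ = set⇒↭ (range1-unique (M + M))
    (Unique.++⁺ (range1-unique M)
      (map-unique (p ∸_) (λ x∈ y∈ → ∸-cancelˡ-≡ (≤p x∈) (≤p y∈)) (range1-unique M))
      λ (x∈ , x∈′) → let (y , y∈ , x≡) = ∈-map⁻ (p ∸_) x∈′ in
        <⇒≱ (M<p∸ y∈) (subst (_≤ M) x≡ (proj₂ (∈-range1⁻ x∈))))
    to from
    where
    ≤p : ∀ {x} → x ∈ range1 M → x ≤ p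
    ≤p x∈ = m≤n⇒m≤1+n (≤-trans (proj₂ (∈-range1⁻ x∈)) (m≤m+n M M))
    M<p∸ : ∀ {y} → y ∈ range1 M → M < p ∸ y
    M<p∸ {y} y∈ = m+n≤o⇒m≤o∸n (suc M) (s≤s (+-monoʳ-≤ M (proj₂ (∈-range1⁻ y∈))))
    to : ∀ {x} → x ∈ range1 (M + M) → x ∈ range1 M ++ map (p ∸_) (range1 M)
    to {x} x∈ with ∈-range1⁻ x∈ | x ≤? M
    ... | 1≤x , _    | yes x≤M = ∈-++⁺ˡ (∈-range1⁺ 1≤x x≤M)
    ... | 1≤x , x≤2M | no  x≰M = ∈-++⁺ʳ (range1 M) (subst (_∈ map (p ∸_) (range1 M))
            (m∸[m∸n]≡n x≤p) (∈-map⁺ (p ∸_) (∈-range1⁺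
              (m<n⇒0<n∸m (s≤s x≤2M))
              (≤-trans (∸-monoʳ-≤ p (≰⇒> x≰M)) (≤-reflexive (m+n∸m≡n M M))))))
      where
      x≤p : x ≤ p
      x≤p = m≤n⇒m≤1+n x≤2M
    from : ∀ {x} → x ∈ range1 M ++ map (p ∸_) (range1 M) → x ∈ range1 (M + M)
    from x∈ with ∈-++⁻ (range1 M) x∈
    ... | inj₁ x∈M = let (1≤x , x≤M) = ∈-range1⁻ x∈M in ∈-range1⁺ 1≤x (≤-trans x≤M (m≤m+n M M))
    ... | inj₂ x∈′ with ∈-map⁻ (p ∸_) x∈′
    ...   | (y , y∈ , refl) = ∈-range1⁺ (≤-trans z<s (M<p∸ y∈)) (∸-monoʳ-≤ p (proj₁ (∈-range1⁻ {M} y∈)))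

  -- Reflecting the upper half of the units gives (p - 1)! ≡ (-1)^M (M!)², and the sign disappears
  -- because M = 2k. Wilson's theorem evaluates the left side; `1 ≤ k` makes p - 1 different from 1.
  half!²≈-1 : 1 ≤ k → + product (range1 M) ℤ.* + product (range1 M) ≈ -1ℤ
  half!²≈-1 1≤k = begin
    + P ℤ.* + P                        ≡⟨ cong (λ z → + P ℤ.* z) (ℤ.*-identityˡ (+ P)) ⟨
    + P ℤ.* (1ℤ ℤ.* + P)               ≡⟨ cong (λ s → + P ℤ.* (s ℤ.* + P)) (trans (cong (-1ℤ ℤ.^_) (length-range1 M)) (-1^[k+k] k)) ⟨
    + P ℤ.* ((-1ℤ ℤ.^ length (range1 M)) ℤ.* + P)
      ≈⟨ *-congˡ (+ P) (product-negated (range1 M) (λ x∈ → m≤n⇒m≤1+n (≤-trans (proj₂ (∈-range1⁻ x∈)) (m≤m+n M M)))) ⟨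
    + P ℤ.* + product (map (p ∸_) (range1 M))     ≡⟨ ℤ.pos-* P _ ⟨
    + (P * product (map (p ∸_) (range1 M)))       ≡⟨ cong +_ (product-++ (range1 M) _) ⟨
    + product (range1 M ++ map (p ∸_) (range1 M)) ≡⟨ cong +_ (product-↭ units↭) ⟨
    + product (range1 (M + M))         ≈⟨ Wilson.wilson (M + M) pr (<⇒≢ (+-mono-≤ 1≤M 1≤M)) ⟩
    -1ℤ                                ∎
    where
    P = product (range1 M)
    1≤M : 1 ≤ M
    1≤M = ≤-trans 1≤k (m≤m+n k k)

-- Relative position of two chords.

-- For chords a < A and b < B (A, B standing for ā, b̄): the conditions defining X, Y and Z.
crossing disjoint nested : (a A b B : ℕ) → Bool
crossing a A b B = (a <ᵇ b) ∧ ((b <ᵇ A) ∧ (A <ᵇ B))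
disjoint a A b B = (a <ᵇ A) ∧ ((A <ᵇ b) ∧ (b <ᵇ B))
nested   a A b B = (a <ᵇ b) ∧ ((b <ᵇ B) ∧ (B <ᵇ A))

-- The capital letters are the images of the small ones under the map whose order reversals are
-- counted.
inversion : (x X y Y : ℕ) → ℕ
inversion x X y Y = if x <ᵇ y then 𝟙 (Y <ᵇ X) else 0

-- Summed over all ordered pairs of chords, the three identities become `count-pairs`, `count-below`
-- and `count-inversions`. They record the relative position itself, the endpoints of the second
-- chord that are at most a, and the reversals between an endpoint of the first chord and one of the
-- second; `a == b` accounts for a chord compared with itself.
PairIdentities : (a A b B : ℕ) → Set
PairIdentities a A b B =
  1 ≡ 𝟙 (a == b) + (𝟙 (crossing a A b B) + 𝟙 (crossing b B a A))
      + (𝟙 (disjoint a A b B) + 𝟙 (disjoint b B a A))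
      + (𝟙 (nested a A b B) + 𝟙 (nested b B a A))
  × 𝟙 (not (a <ᵇ b)) + 𝟙 (not (a <ᵇ B))
    ≡ 𝟙 (a == b) + 𝟙 (crossing b B a A) + (𝟙 (disjoint b B a A) + 𝟙 (disjoint b B a A))
      + 𝟙 (nested b B a A)
  × (inversion a A b B + inversion a A B b) + (inversion A a b B + inversion A a B b)
    ≡ 𝟙 (a == b) + (𝟙 (crossing a A b B) + 𝟙 (crossing b B a A))
      + ((𝟙 (nested a A b B) + 𝟙 (nested b B a A)) + (𝟙 (nested a A b B) + 𝟙 (nested b B a A)))

-- Unless the chords coincide, the four endpoints are distinct and come in one of six orders. Once
-- the comparisons are rewritten to their values, all three identities hold by computation.
pair-identities : ∀ {a A b B} → a < A → b < B → (a ≡ b → A ≡ B) → (A ≡ B → a ≡ b) → a ≢ B → b ≢ A →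
  PairIdentities a A b B
pair-identities {a} {A} {b} {B} aA bB a≡b⇒A≡B A≡B⇒a≡b a≢B b≢A with <-cmp a b
... | tri≈ _ a≡b _ = equal a≡b (a≡b⇒A≡B a≡b)
  where
  equal : a ≡ b → A ≡ B → PairIdentities a A b B
  equal refl refl rewrite ≥⇒<ᵇ≡false (≤-refl {a}) | ≥⇒<ᵇ≡false (≤-refl {A})
    | <⇒<ᵇ≡true aA | <⇒>ᵇ≡false aA = refl , refl , refl
... | tri< ab a≢b _ with <-cmp A b
...   | tri≈ _ A≡b _ = ⊥-elim (b≢A (sym A≡b))
...   | tri< Ab _ _ rewrite <⇒<ᵇ≡true aA | <⇒<ᵇ≡true bB
        | <⇒<ᵇ≡true ab | <⇒>ᵇ≡false ab | <⇒<ᵇ≡true Ab | <⇒>ᵇ≡false Ab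
        | <⇒<ᵇ≡true (<-trans ab bB) | <⇒>ᵇ≡false (<-trans ab bB)
        | <⇒<ᵇ≡true (<-trans Ab bB) | <⇒>ᵇ≡false (<-trans Ab bB) = refl , refl , refl
...   | tri> _ _ bA with <-cmp A B
...     | tri≈ _ A≡B _ = ⊥-elim (a≢b (A≡B⇒a≡b A≡B))
...     | tri< AB _ _ rewrite <⇒<ᵇ≡true aA | <⇒<ᵇ≡true bB
          | <⇒<ᵇ≡true ab | <⇒>ᵇ≡false ab | <⇒<ᵇ≡true bA | <⇒>ᵇ≡false bA
          | <⇒<ᵇ≡true (<-trans ab bB) | <⇒>ᵇ≡false (<-trans ab bB)
          | <⇒<ᵇ≡true AB | <⇒>ᵇ≡false AB = refl , refl , refl
...     | tri> _ _ BA rewrite <⇒<ᵇ≡true aA | <⇒<ᵇ≡true bB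
          | <⇒<ᵇ≡true ab | <⇒>ᵇ≡false ab | <⇒<ᵇ≡true bA | <⇒>ᵇ≡false bA
          | <⇒<ᵇ≡true (<-trans ab bB) | <⇒>ᵇ≡false (<-trans ab bB)
          | <⇒<ᵇ≡true BA | <⇒>ᵇ≡false BA = refl , refl , refl
pair-identities {a} {A} {b} {B} aA bB _ A≡B⇒a≡b a≢B b≢A | tri> _ a≢b ba with <-cmp B a
...   | tri≈ _ B≡a _ = ⊥-elim (a≢B (sym B≡a))
...   | tri< Ba _ _ rewrite <⇒<ᵇ≡true aA | <⇒<ᵇ≡true bB
        | <⇒<ᵇ≡true ba | <⇒>ᵇ≡false ba | <⇒<ᵇ≡true Ba | <⇒>ᵇ≡false Ba
        | <⇒>ᵇ≡false (<-trans ba aA)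
        | <⇒>ᵇ≡false (<-trans Ba aA) = refl , refl , refl
...   | tri> _ _ aB with <-cmp A B
...     | tri≈ _ A≡B _ = ⊥-elim (a≢b (A≡B⇒a≡b A≡B))
...     | tri< AB _ _ rewrite <⇒<ᵇ≡true aA | <⇒<ᵇ≡true bB
          | <⇒<ᵇ≡true ba | <⇒>ᵇ≡false ba | <⇒<ᵇ≡true aB | <⇒>ᵇ≡false aB
          | <⇒<ᵇ≡true (<-trans ba aA) | <⇒>ᵇ≡false (<-trans ba aA)
          | <⇒<ᵇ≡true AB | <⇒>ᵇ≡false AB = refl , refl , refl
...     | tri> _ _ BA rewrite <⇒<ᵇ≡true aA | <⇒<ᵇ≡true bB
          | <⇒<ᵇ≡true ba | <⇒>ᵇ≡false ba | <⇒<ᵇ≡true aB | <⇒>ᵇ≡false aB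
          | <⇒<ᵇ≡true (<-trans ba aA) | <⇒>ᵇ≡false (<-trans ba aA)
          | <⇒<ᵇ≡true BA | <⇒>ᵇ≡false BA = refl , refl , refl

-- The map `tilde` and its characterisation up to sign.

module Chords (p : ℕ) .{{_ : NonZero p}} (p≡ : p ≡ suc (half p + half p))
  (t²≈-1 : Congruence._≈_ p (+ t p ℤ.* + t p) -1ℤ) where

  open Congruence p

  private
    M = half p
    R = range1 M
    T = + t p

  +<p : ∀ {m n} → m ≤ M → n ≤ M → m + n < p
  +<p m≤M n≤M = subst (_ <_) (sym p≡) (s≤s (+-mono-≤ m≤M n≤M))

  ≤M⇒<p : ∀ {n} → n ≤ M → n < p
  ≤M⇒<p n≤M = +<p z≤n n≤M

  signed : Bool → ℤ → ℤ
  signed s z = if s then - z else z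

  signed≈± : ∀ s {x z} → x ≈ signed s z → x ≈± z
  signed≈± false = inj₁
  signed≈± true  = inj₂

  negative : ℕ → Bool
  negative n = p <ᵇ 2 * (n % p)

  tilde-signed : ∀ n → + n ≈ signed (negative n) (+ tilde p n)
  tilde-signed n with p <ᵇ 2 * (n % p)
  ... | false = %-≈ n
  ... | true  = ≈-trans (%-≈ n) (≈-trans (≡⇒≈ (sym (ℤ.neg-involutive (+ (n % p)))))
                  (neg-cong (≈-sym (p∸-≈ (<⇒≤ (m%n<n n p))))))

  2*≡+ : ∀ n → 2 * n ≡ n + n
  2*≡+ n = cong (_+_ n) (+-identityʳ n)

  M<⇒p<2* : ∀ {n} → M < n → p < 2 * n
  M<⇒p<2* {n} M<n = begin-strict
    p              ≡⟨ p≡ ⟩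
    suc (M + M)    ≡⟨ +-suc M M ⟨
    M + suc M      <⟨ +-monoˡ-< (suc M) (n<1+n M) ⟩
    suc M + suc M  ≤⟨ +-mono-≤ M<n M<n ⟩
    n + n          ≡⟨ 2*≡+ n ⟨
    2 * n          ∎
    where open ≤-Reasoning

  p∸≤M : ∀ {n} → M < n → p ∸ n ≤ M
  p∸≤M {n} M<n = begin
    p ∸ n                ≤⟨ ∸-monoʳ-≤ p M<n ⟩
    p ∸ suc M            ≡⟨ cong (_∸ suc M) p≡ ⟩
    suc (M + M) ∸ suc M  ≡⟨ m+n∸m≡n M M ⟩
    M                    ∎
    where open ≤-Reasoning

  tilde≤M : ∀ n → tilde p n ≤ M
  tilde≤M n with n % p ≤? M
  ... | yes r≤M rewrite ≥⇒<ᵇ≡false (subst (_≤ p) (sym (2*≡+ (n % p))) (<⇒≤ (+<p r≤M r≤M))) = r≤M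
  ... | no  r≰M rewrite <⇒<ᵇ≡true (M<⇒p<2* (≰⇒> r≰M)) = p∸≤M (≰⇒> r≰M)

  tilde-≈± : ∀ n → + n ≈± + tilde p n
  tilde-≈± n = signed≈± (negative n) (tilde-signed n)

  -- The numbers up to M have pairwise sums below p, so a class up to sign contains at most one of
  -- them. All later evaluations of `tilde` and `bar` rest on this.
  tilde-unique : ∀ {n m} → m ≤ M → + n ≈± + m → tilde p n ≡ m
  tilde-unique {n} {m} m≤M n≈±m = ≈±⇒≡ (≤M⇒<p (tilde≤M n)) (≤M⇒<p m≤M) (+<p (tilde≤M n) m≤M)
    (≈±-trans (≈±-sym (tilde-≈± n)) n≈±m)

  -- Folding a pair into its difference and its reflected sum.

  data Folded (a b e : ℕ) : Set where
    unreflected : e ≡ a + b → Folded a b e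
    -- Expresses e = p - (a + b) without truncated subtraction, with p written as 2M + 1.
    reflected   : e + (a + b) ≡ suc (M + M) → Folded a b e

  folded : ∀ {a b} → a ≤ M → b ≤ M → Folded a b (tilde p (a + b))
  folded {a} {b} a≤M b≤M with a + b ≤? M
  ... | yes s≤M = unreflected (tilde-unique s≤M (inj₁ ≈-refl))
  ... | no  s≰M = reflected (trans
          (cong (_+ (a + b)) (tilde-unique (p∸≤M (≰⇒> s≰M)) (≈±-sym (inj₂ (p∸-≈ s≤p)))))
          (trans (m∸n+n≡m s≤p) p≡))
    where
    s≤p = <⇒≤ (+<p a≤M b≤M)

  Folded⇒tilde : ∀ {a b e} → e ≤ M → Folded a b e → tilde p (a + b) ≡ e
  Folded⇒tilde e≤M (unreflected refl) = tilde-unique e≤M (inj₁ ≈-refl)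
  Folded⇒tilde {a} {b} {e} e≤M (reflected eq) = tilde-unique e≤M (inj₂ (≈-trans
    (≡⇒≈ (lem (+ e) (+ (a + b))))
    (≈-trans (+-cong (≈-trans (≡⇒≈ (cong +_ (trans eq (sym p≡)))) p≈0) (≈-refl { - + e}))
      (≡⇒≈ (ℤ.+-identityˡ (- + e))))))
    where
    lem : ∀ e s → s ≡ e ℤ.+ s ℤ.+ - e
    lem = ℤ-Solver.solve-∀

  ∈R⇒≤M : ∀ {a} → a ∈ R → a ≤ M
  ∈R⇒≤M a∈ = proj₂ (∈-range1⁻ a∈)

  ∈R⇒≥1 : ∀ {a} → a ∈ R → 1 ≤ a
  ∈R⇒≥1 {a} a∈ = proj₁ (∈-range1⁻ {M} a∈)

  -- The difference e − d is 2a in the first case and p − 2(a + d) in the second.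
  difference<folded-sum : ∀ {a d e} → 1 ≤ a → a + d ≤ M → Folded a (a + d) e → d < e
  difference<folded-sum {a} {d} 1≤a _ (unreflected refl) = +-mono-≤ 1≤a (m≤n+m d a)
  difference<folded-sum {a} {d} {e} _ b≤M (reflected eq) = +-cancelʳ-< (a + (a + d)) d e (begin-strict
    d + (a + (a + d))  ≡⟨ lem a d ⟩
    (a + d) + (a + d)  ≤⟨ +-mono-≤ b≤M b≤M ⟩
    M + M              <⟨ n<1+n (M + M) ⟩
    suc (M + M)        ≡⟨ eq ⟨
    e + (a + (a + d))  ∎)
    where
    open ≤-Reasoning
    lem : ∀ a d → d + (a + (a + d)) ≡ (a + d) + (a + d)
    lem = ℕ-Solver.solve-∀

  +-double-injective : ∀ {m n} → m + m ≡ n + n → m ≡ n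
  +-double-injective {m} {n} eq = *-cancelˡ-≡ m n 2 (trans (2*≡+ m) (trans eq (sym (2*≡+ n))))

  +-double≢odd : ∀ m n → m + m ≢ suc (n + n)
  +-double≢odd m n eq = even≢odd m n (trans (2*≡+ m) (trans eq (cong suc (sym (2*≡+ n)))))

  -- The parity of e − d tells the two cases of Folded apart.
  Folded-injective : ∀ {a a′ d e} → Folded a (a + d) e → Folded a′ (a′ + d) e → a ≡ a′
  Folded-injective {a} {a′} {d} (unreflected refl) (unreflected eq) = +-double-injective
    (+-cancelʳ-≡ d (a + a) (a′ + a′) (trans (+-assoc a a d) (trans eq (sym (+-assoc a′ a′ d)))))
  Folded-injective {a} {a′} {d} {e} (reflected eq) (reflected eq′) = +-double-injective
    (+-cancelʳ-≡ d (a + a) (a′ + a′) (trans (+-assoc a a d)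
      (trans (+-cancelˡ-≡ e _ _ (trans eq (sym eq′))) (sym (+-assoc a′ a′ d)))))
  Folded-injective {a} {a′} {d} (unreflected refl) (reflected eq) =
    ⊥-elim (+-double≢odd (a + a′ + d) M (trans (lem a a′ d) eq))
    where
    lem : ∀ a a′ d → (a + a′ + d) + (a + a′ + d) ≡ a + (a + d) + (a′ + (a′ + d))
    lem = ℕ-Solver.solve-∀
  Folded-injective {a} {a′} {d} (reflected eq) (unreflected refl) =
    ⊥-elim (+-double≢odd (a + a′ + d) M (trans (lem a a′ d) eq))
    where
    lem : ∀ a a′ d → (a + a′ + d) + (a + a′ + d) ≡ a′ + (a′ + d) + (a + (a + d))
    lem = ℕ-Solver.solve-∀

  halve : ∀ n → ∃ λ c → n ≡ c + c ⊎ n ≡ suc (c + c)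
  halve zero    = 0 , inj₁ refl
  halve (suc n) with halve n
  ... | c , inj₁ eq = c , inj₂ (cong suc eq)
  ... | c , inj₂ eq = suc c , inj₁ (cong suc (trans eq (sym (+-suc c c))))

  -- The parity of e - d selects the case, and the equation e - d = 2a or e - d = p - 2(a + d) is
  -- then solved for a.
  Folded-surjective : ∀ {d e} → d < e → e ≤ M → ∃ λ a → 1 ≤ a × a + d ≤ M × Folded a (a + d) e
  Folded-surjective {d} {e} d<e e≤M with halve (e ∸ d)
  ... | zero , inj₁ eq = ⊥-elim (<⇒≱ d<e (m∸n≡0⇒m≤n eq))
  ... | a@(suc _) , inj₁ eq = a , z<s , ≤-trans (m≤n+m (a + d) a) (subst (_≤ M) e≡ e≤M) , unreflected e≡
    where
    e≡ : e ≡ a + (a + d)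
    e≡ = trans (sym (m∸n+n≡m (<⇒≤ d<e))) (trans (cong (_+ d) eq) (+-assoc a a d))
  ... | c , inj₂ eq = a , ≤-trans (s≤s z≤n) 1+c≤a , subst (_≤ M) (sym a+d≡) (m∸n≤m M c) , reflected (begin
      e + (a + (a + d))                  ≡⟨ cong (λ z → z + (a + (a + d))) e≡ ⟩
      (suc (c + c) + d) + (a + (a + d))  ≡⟨ lem a c d ⟩
      suc ((a + (c + d)) + (a + (c + d))) ≡⟨ cong (λ z → suc (z + z)) a+c+d≡M ⟩
      suc (M + M)                        ∎)
    where
    open ≡-Reasoning
    -- From 2c + 1 = p - 2(a + d) it follows that a + d = M - c.
    a = M ∸ (c + d)
    e≡ : e ≡ suc (c + c) + d
    e≡ = trans (sym (m∸n+n≡m (<⇒≤ d<e))) (cong (_+ d) eq)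
    1+c+[c+d]≤M : suc c + (c + d) ≤ M
    1+c+[c+d]≤M = subst (_≤ M) (trans e≡ (cong suc (+-assoc c c d))) e≤M
    1+c≤a : suc c ≤ a
    1+c≤a = m+n≤o⇒m≤o∸n (suc c) 1+c+[c+d]≤M
    a+c+d≡M : a + (c + d) ≡ M
    a+c+d≡M = m∸n+n≡m (≤-trans (m≤n+m (c + d) (suc c)) 1+c+[c+d]≤M)
    a+d≡ : a + d ≡ M ∸ c
    a+d≡ = sym (trans (cong (_∸ c) (trans (sym a+c+d≡M) (lem′ a c d))) (m+n∸n≡m (a + d) c))
      where
      lem′ : ∀ a c d → a + (c + d) ≡ a + d + c
      lem′ = ℕ-Solver.solve-∀
    lem : ∀ a c d → (suc (c + c) + d) + (a + (a + d)) ≡ suc ((a + (c + d)) + (a + (c + d)))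
    lem = ℕ-Solver.solve-∀

  private
    ordered? = λ (ab : ℕ × ℕ) → proj₁ ab <? proj₂ ab

  ordered-pairs : List (ℕ × ℕ)
  ordered-pairs = filter ordered? (cartesianProduct R R)

  ∈-ordered-pairs⁺ : ∀ {a b} → 1 ≤ a → a < b → b ≤ M → (a , b) ∈ ordered-pairs
  ∈-ordered-pairs⁺ 1≤a a<b b≤M = ∈-filter⁺ ordered? (∈-cartesianProduct⁺
    (∈-range1⁺ 1≤a (≤-trans (<⇒≤ a<b) b≤M)) (∈-range1⁺ (≤-trans 1≤a (<⇒≤ a<b)) b≤M)) a<b

  ∈-ordered-pairs⁻ : ∀ {a b} → (a , b) ∈ ordered-pairs → a ∈ R × b ∈ R × a < b
  ∈-ordered-pairs⁻ ab∈ =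
    let (ab∈R , a<b) = ∈-filter⁻ ordered? {xs = cartesianProduct R R} ab∈
        (a∈ , b∈) = ∈-cartesianProduct⁻ R R ab∈R
    in a∈ , b∈ , a<b

  fold : ℕ × ℕ → ℕ × ℕ
  fold (a , b) = ∣ a - b ∣ , tilde p (a + b)

  -- The image is an arbitrary pair `(d , e)`, so that two pairs with equal images are described by
  -- the same d and e, as `Folded-injective` requires.
  fold-Folded : ∀ {a b d e} → a < b → b ≤ M → fold (a , b) ≡ (d , e) → b ≡ a + d × Folded a (a + d) e
  fold-Folded {a} {b} a<b b≤M refl = b≡ ,
    subst (λ c → Folded a c (tilde p (a + b))) b≡ (folded (≤-trans (<⇒≤ a<b) b≤M) b≤M)
    where
    b≡ : b ≡ a + ∣ a - b ∣
    b≡ = sym (trans (cong (_+_ a) (m≤n⇒∣m-n∣≡n∸m (<⇒≤ a<b))) (m+[n∸m]≡n (<⇒≤ a<b)))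

  fold-injective : ∀ {a b a′ b′} → a < b → b ≤ M → a′ < b′ → b′ ≤ M →
    fold (a , b) ≡ fold (a′ , b′) → (a , b) ≡ (a′ , b′)
  fold-injective a<b b≤M a′<b′ b′≤M eq with fold-Folded a<b b≤M eq | fold-Folded a′<b′ b′≤M refl
  ... | b≡ , F | b′≡ , F′ with Folded-injective F F′
  ... | refl = cong (_ ,_) (trans b≡ (sym b′≡))

  fold-surjective : ∀ {d e} → 1 ≤ d → d < e → e ≤ M →
    ∃ λ ab → ab ∈ ordered-pairs × fold ab ≡ (d , e)
  fold-surjective {d} {e} 1≤d d<e e≤M with Folded-surjective d<e e≤M
  ... | a , 1≤a , b≤M , F = (a , a + d) , ∈-ordered-pairs⁺ 1≤a (m<m+n a 1≤d) b≤M
      , cong₂ _,_ (trans (m≤n⇒∣m-n∣≡n∸m (m≤m+n a d)) (m+n∸m≡n a d)) (Folded⇒tilde e≤M F)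

  fold-comm : ∀ a b → fold (a , b) ≡ fold (b , a)
  fold-comm a b = cong₂ _,_ (∣-∣-comm a b) (cong (tilde p) (+-comm a b))

  fold-ordered-≤ : ∀ {a b} → a ∈ R → b ∈ R → a ≤ b → ∣ a - b ∣ < tilde p (a + b)
  fold-ordered-≤ {a} {b} a∈ b∈ a≤b with m≤n⇒∃[o]m+o≡n a≤b
  ... | d , refl = subst (_< tilde p (a + b)) (sym (trans (m≤n⇒∣m-n∣≡n∸m a≤b) (m+n∸m≡n a d)))
    (difference<folded-sum (∈R⇒≥1 a∈) (∈R⇒≤M b∈) (folded (∈R⇒≤M a∈) (∈R⇒≤M b∈)))

  -- `fold` is symmetric, so the order of a and b is immaterial; this matters for ā and b̄, whose
  -- order is not known.
  fold-ordered : ∀ {a b} → a ∈ R → b ∈ R → ∣ a - b ∣ < tilde p (a + b)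
  fold-ordered {a} {b} a∈ b∈ with ≤-total a b
  ... | inj₁ a≤b = fold-ordered-≤ a∈ b∈ a≤b
  ... | inj₂ b≤a = subst (λ de → proj₁ de < proj₂ de) (fold-comm b a) (fold-ordered-≤ b∈ a∈ b≤a)

  ordered-pairs-unique : Unique ordered-pairs
  ordered-pairs-unique = Unique.filter⁺ ordered? (Unique.cartesianProduct⁺ (range1-unique M) (range1-unique M))

  fold-↭ : map fold ordered-pairs ↭ ordered-pairs
  fold-↭ = bijection⇒↭ fold ordered-pairs-unique ordered-pairs-unique
    (λ ab∈ → let (a∈ , b∈ , a<b) = ∈-ordered-pairs⁻ ab∈ in
      ∈-ordered-pairs⁺ (n≢0⇒n>0 (λ eq → <⇒≢ a<b (∣m-n∣≡0⇒m≡n eq))) (fold-ordered a∈ b∈) (tilde≤M _))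
    (λ ab∈ ab∈′ → let (_ , b∈ , a<b) = ∈-ordered-pairs⁻ ab∈ ; (_ , b∈′ , a<b′) = ∈-ordered-pairs⁻ ab∈′ in
      fold-injective a<b (∈R⇒≤M b∈) a<b′ (∈R⇒≤M b∈′))
    (λ de∈ → let (d∈ , e∈ , d<e) = ∈-ordered-pairs⁻ de∈ in
      fold-surjective (∈R⇒≥1 d∈) d<e (∈R⇒≤M e∈))

  -- Multiplication by t and the involution a ↦ ā.

  private
    infix 9 _⋆
    _⋆ : ℕ → ℕ
    a ⋆ = bar p a

  -- The sign in ta ≡ ±ā, with `true` for minus.
  flips : ℕ → Bool
  flips a = negative (t p * a)

  t*-signed : ∀ a → T ℤ.* + a ≈ signed (flips a) (+ (a ⋆))
  t*-signed a = ≈-trans (≡⇒≈ (sym (ℤ.pos-* (t p) a))) (tilde-signed (t p * a))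

  bar-unique : ∀ {n m} → m ≤ M → T ℤ.* + n ≈± + m → n ⋆ ≡ m
  bar-unique {n} m≤M tn≈±m = tilde-unique m≤M (≈±-trans (inj₁ (≡⇒≈ (ℤ.pos-* (t p) n))) tn≈±m)

  t*t* : ∀ z → T ℤ.* (T ℤ.* z) ≈ - z
  t*t* z = ≈-trans (≡⇒≈ (sym (ℤ.*-assoc T T z))) (≈-trans (*-congʳ z t²≈-1) (≡⇒≈ (ℤ.-1*i≡-i z)))

  -- Multiplying ta ≡ ±ā by t gives tā ≡ ∓a because t² ≡ -1, and `tilde` ignores the sign.
  bar-involutive : ∀ {a} → a ∈ R → (a ⋆) ⋆ ≡ a
  bar-involutive {a} a∈ = bar-unique (∈R⇒≤M a∈)
    (≈±-trans (≈±-*-congˡ T (≈±-sym (signed≈± (flips a) (t*-signed a)))) (inj₂ (t*t* (+ a))))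

  bar-∈ : ∀ {a} → a ∈ R → a ⋆ ∈ R
  bar-∈ {a} a∈ = ∈-range1⁺ (n≢0⇒n>0 bar≢0) (tilde≤M (t p * a))
    where
    0⋆≡0 : 0 ⋆ ≡ 0
    0⋆≡0 = bar-unique z≤n (inj₁ (≡⇒≈ (ℤ.*-zeroʳ T)))
    bar≢0 : a ⋆ ≢ 0
    bar≢0 eq = >⇒≢ (∈R⇒≥1 a∈) (trans (sym (bar-involutive a∈)) (trans (cong (bar p) eq) 0⋆≡0))

  -- Otherwise p would divide 2a, which lies strictly between 0 and p.
  ≈-self⇒⊥ : ∀ {a} → a ∈ R → + a ≈ - + a → ⊥
  ≈-self⇒⊥ {a} a∈ a≈-a = >⇒≢ (∈R⇒≥1 a∈) (m+n≡0⇒m≡0 a (≈0⇒≡0 (+<p (∈R⇒≤M a∈) (∈R⇒≤M a∈))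
    (≈-trans (+-cong a≈-a (≈-refl {+ a})) (≡⇒≈ (ℤ.+-inverseˡ (+ a))))))

  -- If ta ≡ sā and tā ≡ s′a with signs s and s′, then -a ≡ t²a ≡ ss′a. Equal signs would give a ≡
  -- -a.
  flips-bar : ∀ {a} → a ∈ R → flips (a ⋆) ≡ not (flips a)
  flips-bar {a} a∈ = go (flips a) (flips (a ⋆)) (t*-signed a)
    (subst (λ b → T ℤ.* + (a ⋆) ≈ signed (flips (a ⋆)) (+ b)) (bar-involutive a∈) (t*-signed (a ⋆)))
    where
    open Relation.Binary.Reasoning.Setoid ≈-setoid
    go : ∀ s s′ → T ℤ.* + a ≈ signed s (+ (a ⋆)) → T ℤ.* + (a ⋆) ≈ signed s′ (+ a) → s′ ≡ not s
    go false true  _  _  = refl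
    go true  false _  _  = refl
    go false false e e′ = ⊥-elim (≈-self⇒⊥ a∈ (begin
      + a                  ≈⟨ e′ ⟨
      T ℤ.* + (a ⋆)         ≈⟨ *-congˡ T e ⟨
      T ℤ.* (T ℤ.* + a)    ≈⟨ t*t* (+ a) ⟩
      - + a                ∎))
    go true  true  e e′ = ⊥-elim (≈-self⇒⊥ a∈ (begin
      + a                        ≡⟨ ℤ.neg-involutive (+ a) ⟨
      - - + a                    ≈⟨ neg-cong e′ ⟨
      - (T ℤ.* + (a ⋆))           ≡⟨ ℤ.neg-distribʳ-* T (+ (a ⋆)) ⟩
      T ℤ.* (- + (a ⋆))           ≈⟨ *-congˡ T e ⟨
      T ℤ.* (T ℤ.* + a)          ≈⟨ t*t* (+ a) ⟩
      - + a                      ∎))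

  -- At a fixed point `flips-bar` would make a sign equal to its own negation.
  bar-free : ∀ {a} → a ∈ R → a ⋆ ≢ a
  bar-free {a} a∈ eq = not-¬ refl (trans (cong flips (sym eq)) (flips-bar a∈))

  swap-if : Bool → ℕ × ℕ → ℕ × ℕ
  swap-if s = if s then swap else (λ de → de)

  bar₂ : ℕ × ℕ → ℕ × ℕ
  bar₂ (a , b) = a ⋆ , b ⋆

  -- From t(a ∓ b) = ta ∓ tb and ta = ±a⋆, tb = ±b⋆.
  bar₂-fold : ∀ {a b} → a ∈ R → b ∈ R →
    bar₂ (fold (a , b)) ≡ swap-if (flips a xor flips b) (fold (a ⋆ , b ⋆))
  bar₂-fold {a} {b} a∈ b∈ = go (flips a) (flips b) (t*-signed a) (t*-signed b)
    where
    a⋆ = + (a ⋆)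
    b⋆ = + (b ⋆)
    dist : ∀ t a b → t ℤ.* (a ℤ.- b) ≡ t ℤ.* a ℤ.- t ℤ.* b
    dist = ℤ-Solver.solve-∀
    difference : ∀ {m} {x y w} → m ≤ M → T ℤ.* + a ≈ x → T ℤ.* + b ≈ y → x ℤ.- y ≈± w → + m ≈± w →
      ∣ a - b ∣ ⋆ ≡ m
    difference m≤M ta≈x tb≈y x-y≈±w m≈±w = bar-unique m≤M (≈±-trans (≈±-*-congˡ T (∣-∣≈± a b))
      (≈±-trans (inj₁ (≈-trans (≡⇒≈ (dist T (+ a) (+ b))) (+-cong ta≈x (neg-cong tb≈y))))
      (≈±-trans x-y≈±w (≈±-sym m≈±w))))
    total : ∀ {m} {x y w} → m ≤ M → T ℤ.* + a ≈ x → T ℤ.* + b ≈ y → x ℤ.+ y ≈± w → + m ≈± w →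
      (tilde p (a + b)) ⋆ ≡ m
    total m≤M ta≈x tb≈y x+y≈±w m≈±w = bar-unique m≤M (≈±-trans (≈±-*-congˡ T (≈±-sym (tilde-≈± (a + b))))
      (≈±-trans (inj₁ (≈-trans (≡⇒≈ (ℤ.*-distribˡ-+ T (+ a) (+ b))) (+-cong ta≈x tb≈y)))
      (≈±-trans x+y≈±w (≈±-sym m≈±w))))
    d≤M : ∣ a ⋆ - b ⋆ ∣ ≤ M
    d≤M = ≤-trans (∣m-n∣≤m⊔n (a ⋆) (b ⋆)) (⊔-lub (tilde≤M _) (tilde≤M _))
    e≤M : tilde p (a ⋆ + b ⋆) ≤ M
    e≤M = tilde≤M _
    d≈± : + ∣ a ⋆ - b ⋆ ∣ ≈± a⋆ ℤ.- b⋆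
    d≈± = ∣-∣≈± (a ⋆) (b ⋆)
    e≈± : + tilde p (a ⋆ + b ⋆) ≈± a⋆ ℤ.+ b⋆
    e≈± = ≈±-sym (tilde-≈± (a ⋆ + b ⋆))
    same : ∀ {x y} → x ≡ y → x ≈± y
    same eq = inj₁ (≡⇒≈ eq)
    opposite : ∀ {x y} → x ≡ - y → x ≈± y
    opposite eq = inj₂ (≡⇒≈ eq)
    lem₁ : ∀ x y → x ℤ.- (- y) ≡ x ℤ.+ y
    lem₁ = ℤ-Solver.solve-∀
    lem₂ : ∀ x y → - x ℤ.- y ≡ - (x ℤ.+ y)
    lem₂ = ℤ-Solver.solve-∀
    lem₃ : ∀ x y → - x ℤ.+ y ≡ - (x ℤ.- y)
    lem₃ = ℤ-Solver.solve-∀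
    lem₄ : ∀ x y → - x ℤ.- (- y) ≡ - (x ℤ.- y)
    lem₄ = ℤ-Solver.solve-∀
    go : ∀ s s′ → T ℤ.* + a ≈ signed s a⋆ → T ℤ.* + b ≈ signed s′ b⋆ →
      bar₂ (fold (a , b)) ≡ swap-if (s xor s′) (fold (a ⋆ , b ⋆))
    go false false ta tb = cong₂ _,_ (difference d≤M ta tb (same refl) d≈±)
                                     (total e≤M ta tb (same refl) e≈±)
    go false true  ta tb = cong₂ _,_ (difference e≤M ta tb (same (lem₁ a⋆ b⋆)) e≈±)
                                     (total d≤M ta tb (same refl) d≈±)
    go true  false ta tb = cong₂ _,_ (difference e≤M ta tb (opposite (lem₂ a⋆ b⋆)) e≈±)
                                     (total d≤M ta tb (opposite (lem₃ a⋆ b⋆)) d≈±)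
    go true  true  ta tb = cong₂ _,_ (difference d≤M ta tb (opposite (lem₄ a⋆ b⋆)) d≈±)
                                     (total e≤M ta tb (opposite (lem₂ a⋆ b⋆)) e≈±)

  -- Sums over points as sums over chords.

  V-∈R : ∀ {a} → a ∈ V p → a ∈ R
  V-∈R a∈ = proj₁ (∈-filter⁻ (λ x → x <? x ⋆) {xs = R} a∈)

  V-<bar : ∀ {a} → a ∈ V p → a < a ⋆
  V-<bar a∈ = proj₂ (∈-filter⁻ (λ x → x <? x ⋆) {xs = R} a∈)

  V-unique : Unique (V p)
  V-unique = Unique.filter⁺ (λ x → x <? x ⋆) (range1-unique M)

  -- The involution `bar` has no fixed points, so {1, ..., M} splits into V and its image.
  ∑-chords : ∀ f → ∑ R f ≡ ∑ (V p) (λ a → f a + f (a ⋆))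
  ∑-chords f = begin
    ∑ R f                                  ≡⟨ ∑-↭ (involution⇒↭ (bar p) (range1-unique M) bar-∈ bar-involutive bar-free) f ⟩
    ∑ (V p ++ map (bar p) (V p)) f         ≡⟨ ∑-++ (V p) _ f ⟩
    ∑ (V p) f + ∑ (map (bar p) (V p)) f    ≡⟨ cong (λ z → ∑ (V p) f + z) (∑-map (bar p) (V p) f) ⟩
    ∑ (V p) f + ∑ (V p) (f ∘ bar p)        ≡⟨ ∑-+ (V p) f (f ∘ bar p) ⟨
    ∑ (V p) (λ a → f a + f (a ⋆))          ∎
    where open ≡-Reasoning

  private
    k = length (V p)

  M≡k+k : M ≡ k + k
  M≡k+k = begin
    M                             ≡⟨ length-range1 M ⟨
    length R                      ≡⟨ ∑-one R ⟨
    ∑ R (λ _ → 1)                 ≡⟨ ∑-chords (λ _ → 1) ⟩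
    ∑ (V p) (λ _ → 1 + 1)         ≡⟨ ∑-+ (V p) (λ _ → 1) (λ _ → 1) ⟩
    ∑ (V p) (λ _ → 1) + ∑ (V p) (λ _ → 1) ≡⟨ cong₂ _+_ (∑-one (V p)) (∑-one (V p)) ⟩
    k + k                         ∎
    where open ≡-Reasoning

  -- Signs and the number of inversions.

  𝟙+𝟙-not : ∀ s → 𝟙 s + 𝟙 (not s) ≡ 1
  𝟙+𝟙-not false = refl
  𝟙+𝟙-not true  = refl

  -- By `flips-bar` each chord has exactly one endpoint whose sign is minus.
  ∑-flips : ∑ R (λ a → 𝟙 (flips a)) ≡ k
  ∑-flips = trans (∑-chords (λ a → 𝟙 (flips a))) (trans
    (∑-cong (V p) (λ {a} a∈ → trans (cong (λ s → 𝟙 (flips a) + 𝟙 s) (flips-bar (V-∈R a∈))) (𝟙+𝟙-not (flips a))))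
    (∑-one (V p)))

  ∑-not-flips : ∑ R (λ a → 𝟙 (not (flips a))) ≡ k
  ∑-not-flips = trans (∑-chords (λ a → 𝟙 (not (flips a)))) (trans
    (∑-cong (V p) (λ {a} a∈ → trans (cong (λ s → 𝟙 (not (flips a)) + 𝟙 (not s)) (flips-bar (V-∈R a∈))) (𝟙+𝟙-not (not (flips a)))))
    (∑-one (V p)))

  ∑-ordered-pairs : ∀ f → ∑ ordered-pairs f ≡ ∑ R (λ a → ∑ R (λ b → if a <ᵇ b then f (a , b) else 0))
  ∑-ordered-pairs f = trans (∑-filter ordered? (cartesianProduct R R) f) (∑-cartesianProduct R R _)

  xor-split : ∀ a b →
    (if a <ᵇ b then 𝟙 (flips a) * 𝟙 (not (flips b)) else 0) +
    (if a <ᵇ b then 𝟙 (flips b) * 𝟙 (not (flips a)) else 0)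
      ≡ (if a <ᵇ b then 𝟙 (flips a xor flips b) else 0)
  xor-split a b with a <ᵇ b | flips a | flips b
  ... | false | _     | _     = refl
  ... | true  | false | false = refl
  ... | true  | false | true  = refl
  ... | true  | true  | false = refl
  ... | true  | true  | true  = refl

  -- On the diagonal, where both comparisons fail, the right side vanishes as well: a sign is not
  -- both minus and plus.
  order-split : ∀ a b →
    (if a <ᵇ b then 𝟙 (flips a) * 𝟙 (not (flips b)) else 0) +
    (if b <ᵇ a then 𝟙 (flips a) * 𝟙 (not (flips b)) else 0)
      ≡ 𝟙 (flips a) * 𝟙 (not (flips b))
  order-split a b with <-cmp a b
  ... | tri< a<b _ _ rewrite <⇒<ᵇ≡true a<b | ≥⇒<ᵇ≡false (<⇒≤ a<b) = +-identityʳ _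
  ... | tri> _ _ b<a rewrite <⇒<ᵇ≡true b<a | ≥⇒<ᵇ≡false (<⇒≤ b<a) = refl
  ... | tri≈ _ refl _ rewrite ≥⇒<ᵇ≡false (≤-refl {a}) with flips a
  ...   | false = refl
  ...   | true  = refl

  -- Two signs differ in two ways, according to which of them is minus. Renaming the variables in
  -- one half of the sum yields all pairs, in whatever order of size, of a point with sign minus and
  -- a point with sign plus: k · k of them.
  ∑-ordered-xor : ∑ ordered-pairs (λ (a , b) → 𝟙 (flips a xor flips b)) ≡ k * k
  ∑-ordered-xor = begin
    ∑ ordered-pairs (λ (a , b) → 𝟙 (flips a xor flips b))
      ≡⟨ ∑-ordered-pairs _ ⟩
    ∑₂ R (λ a b → if a <ᵇ b then 𝟙 (flips a xor flips b) else 0)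
      ≡⟨ ∑₂-cong R (λ {a} {b} _ _ → sym (xor-split a b)) ⟩
    ∑₂ R (λ a b → F a b + (if a <ᵇ b then G b a else 0))
      ≡⟨ ∑₂-+ R F (λ a b → if a <ᵇ b then G b a else 0) ⟩
    ∑₂ R F + ∑₂ R (λ a b → if a <ᵇ b then G b a else 0)
      ≡⟨ cong (λ z → ∑₂ R F + z) (∑-swap R R _) ⟩
    ∑₂ R F + ∑₂ R (λ a b → if b <ᵇ a then G a b else 0)
      ≡⟨ ∑₂-+ R F (λ a b → if b <ᵇ a then G a b else 0) ⟨
    ∑₂ R (λ a b → F a b + (if b <ᵇ a then G a b else 0))
      ≡⟨ ∑₂-cong R (λ {a} {b} _ _ → order-split a b) ⟩
    ∑₂ R G
      ≡⟨ ∑-cong R (λ {a} _ → trans (∑-cong R (λ {b} _ → *-comm (𝟙 (flips a)) (𝟙 (not (flips b)))))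
           (trans (∑-*ʳ R _ (𝟙 (flips a))) (trans (cong (_* 𝟙 (flips a)) ∑-not-flips) (*-comm k (𝟙 (flips a)))))) ⟩
    ∑ R (λ a → 𝟙 (flips a) * k)
      ≡⟨ ∑-*ʳ R _ k ⟩
    ∑ R (λ a → 𝟙 (flips a)) * k
      ≡⟨ cong (_* k) ∑-flips ⟩
    k * k ∎
    where
    open ≡-Reasoning
    G : ℕ → ℕ → ℕ
    G a b = 𝟙 (flips a) * 𝟙 (not (flips b))
    F : ℕ → ℕ → ℕ
    F a b = if a <ᵇ b then G a b else 0

  inverted : ℕ × ℕ → Bool
  inverted (d , e) = e ⋆ <ᵇ d ⋆

  -- By `bar₂-fold` the image is `fold` of ā and b̄, swapped exactly when the signs differ, and an
  -- unswapped value of `fold` is increasing.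
  inverted-fold : ∀ {a b} → a ∈ R → b ∈ R → inverted (fold (a , b)) ≡ (flips a xor flips b)
  inverted-fold {a} {b} a∈ b∈ = trans (cong (λ (d , e) → e <ᵇ d) (bar₂-fold a∈ b∈)) (go (flips a xor flips b))
    where
    lt = fold-ordered (bar-∈ a∈) (bar-∈ b∈)
    go : ∀ s → (λ ((d , e) : ℕ × ℕ) → e <ᵇ d) (swap-if s (fold (a ⋆ , b ⋆))) ≡ s
    go false = ≥⇒<ᵇ≡false (<⇒≤ lt)
    go true  = <⇒<ᵇ≡true lt

  -- Since `fold` permutes the ordered pairs, the inversions of `bar` may be counted at the pairs
  -- `fold (a , b)`, where the signs reveal them.
  inversions : ∑ R (λ x → ∑ R (λ y → if x <ᵇ y then 𝟙 (y ⋆ <ᵇ x ⋆) else 0)) ≡ k * k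
  inversions = begin
    ∑ R (λ x → ∑ R (λ y → if x <ᵇ y then 𝟙 (y ⋆ <ᵇ x ⋆) else 0))
                                             ≡⟨ ∑-ordered-pairs (𝟙 ∘ inverted) ⟨
    ∑ ordered-pairs (𝟙 ∘ inverted)           ≡⟨ ∑-↭ fold-↭ (𝟙 ∘ inverted) ⟨
    ∑ (map fold ordered-pairs) (𝟙 ∘ inverted) ≡⟨ ∑-map fold ordered-pairs (𝟙 ∘ inverted) ⟩
    ∑ ordered-pairs (𝟙 ∘ inverted ∘ fold)    ≡⟨ ∑-cong ordered-pairs (λ ab∈ → let (a∈ , b∈ , _) = ∈-ordered-pairs⁻ ab∈ in cong 𝟙 (inverted-fold a∈ b∈)) ⟩
    ∑ ordered-pairs (λ (a , b) → 𝟙 (flips a xor flips b)) ≡⟨ ∑-ordered-xor ⟩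
    k * k                                    ∎
    where open ≡-Reasoning

  -- The permutation a ↦ ā - a of V.

  gap : ℕ → ℕ
  gap a = ∣ a - a ⋆ ∣

  -- Take b = ā in `bar₂-fold`: the two signs differ, and `bar` exchanges a and ā, which `fold` does
  -- not notice. So `fold` sends a chord to a chord.
  fold-chord : ∀ {a} → a ∈ R → gap a ⋆ ≡ tilde p (a + a ⋆)
  fold-chord {a} a∈ = cong proj₁ (trans (bar₂-fold a∈ (bar-∈ a∈)) (trans
    (cong₂ swap-if flips-differ (cong (λ b → fold (a ⋆ , b)) (bar-involutive a∈)))
    (cong swap (fold-comm (a ⋆) a))))
    where
    flips-differ : flips a xor flips (a ⋆) ≡ true
    flips-differ rewrite flips-bar a∈ with flips a
    ... | false = refl
    ... | true  = refl

  gap-∈V : ∀ {a} → a ∈ V p → gap a ∈ V p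
  gap-∈V {a} a∈ = ∈-filter⁺ (λ x → x <? x ⋆)
    (∈-range1⁺ (n≢0⇒n>0 (λ eq → <⇒≢ (V-<bar a∈) (∣m-n∣≡0⇒m≡n eq))) (≤-trans (<⇒≤ lt) (tilde≤M _)))
    (subst (gap a <_) (sym (fold-chord (V-∈R a∈))) lt)
    where
    lt : gap a < tilde p (a + a ⋆)
    lt = fold-ordered (V-∈R a∈) (bar-∈ (V-∈R a∈))

  gap-injective : ∀ {a b} → a ∈ V p → b ∈ V p → gap a ≡ gap b → a ≡ b
  gap-injective {a} {b} a∈ b∈ eq = cong proj₁ (fold-injective
    (V-<bar a∈) (tilde≤M _) (V-<bar b∈) (tilde≤M _)
    (cong₂ _,_ eq (trans (sym (fold-chord (V-∈R a∈))) (trans (cong (bar p) eq) (fold-chord (V-∈R b∈))))))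

  -- Write (d, d̄) as `fold (a , b)`. Applying `bar` exchanges the components, so `bar₂-fold` shows
  -- that `fold` of ā and b̄ is (d, d̄) too; injectivity of `fold` then makes {ā, b̄} equal to {a,
  -- b}, and hence b = ā.
  gap-surjective : ∀ {d} → d ∈ V p → ∃ λ a → a ∈ V p × gap a ≡ d
  gap-surjective {d} d∈ with fold-surjective (∈R⇒≥1 (V-∈R d∈)) (V-<bar d∈) (tilde≤M _)
  ... | (a , b) , ab∈ , eq = find (flips a xor flips b)
          (trans (sym (bar₂-fold a∈ b∈)) (trans (cong bar₂ eq) (cong (d ⋆ ,_) (bar-involutive (V-∈R d∈)))))
    where
    a∈ = proj₁ (∈-ordered-pairs⁻ ab∈)
    b∈ = proj₁ (proj₂ (∈-ordered-pairs⁻ ab∈))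
    a<b = proj₂ (proj₂ (∈-ordered-pairs⁻ ab∈))
    b⋆≡a : fold (a ⋆ , b ⋆) ≡ (d , d ⋆) → b ⋆ ≡ a
    b⋆≡a eq′ with <-cmp (a ⋆) (b ⋆)
    -- With ā < b̄, injectivity would give the fixed point ā = a.
    ... | tri< lt _ _ = ⊥-elim (bar-free a∈ (cong proj₁
            (fold-injective lt (tilde≤M _) a<b (∈R⇒≤M b∈) (trans eq′ (sym eq)))))
    ... | tri≈ _ a⋆≡b⋆ _ = ⊥-elim (<⇒≢ a<b
            (trans (sym (bar-involutive a∈)) (trans (cong (bar p) a⋆≡b⋆) (bar-involutive b∈))))
    ... | tri> _ _ gt = cong proj₁ (fold-injective gt (tilde≤M _) a<b (∈R⇒≤M b∈)
            (trans (fold-comm (b ⋆) (a ⋆)) (trans eq′ (sym eq))))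
    find : ∀ s → swap-if s (fold (a ⋆ , b ⋆)) ≡ (d ⋆ , d) → ∃ λ a → a ∈ V p × gap a ≡ d
    -- Equal signs would make `fold` of ā and b̄ the decreasing pair (d̄, d).
    find false eq′ = ⊥-elim (<-asym (V-<bar d∈)
      (subst (λ (x , y) → x < y) eq′ (fold-ordered (bar-∈ a∈) (bar-∈ b∈))))
    find true eq′ = a , ∈-filter⁺ (λ x → x <? x ⋆) a∈ (subst (a <_) (sym a⋆≡b) a<b)
      , trans (cong (λ c → ∣ a - c ∣) a⋆≡b) (cong proj₁ eq)
      where
      a⋆≡b : a ⋆ ≡ b
      a⋆≡b = trans (cong (bar p) (sym (b⋆≡a (cong swap eq′)))) (bar-involutive b∈)

  gap-↭ : map gap (V p) ↭ V p
  gap-↭ = bijection⇒↭ gap V-unique V-unique gap-∈V gap-injective gap-surjective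

  -- The lower endpoints contribute S and the upper ones 2S by `gap-↭`, so 3S = 1 + ... + M with M =
  -- 2k. Both sides are doubled to avoid halving M(M + 1).
  3*∑V : ∑ (V p) (λ a → a) * 3 ≡ k * suc (k + k)
  3*∑V = *-cancelʳ-≡ _ _ 2 (begin
    S * 3 * 2                         ≡⟨ lem₁ S ⟩
    (S + (S + S)) * 2                 ≡⟨ cong (λ z → (S + z) * 2) (trans (cong (λ z → S + z) (trans (sym (∑-↭ gap-↭ _)) (∑-map gap (V p) _))) (sym (∑-+ (V p) _ gap))) ⟩
    (S + ∑ (V p) (λ a → a + gap a)) * 2 ≡⟨ cong (λ z → (S + z) * 2) (∑-cong (V p) a+gap) ⟩
    (S + ∑ (V p) (bar p)) * 2         ≡⟨ cong (_* 2) (∑-+ (V p) _ (bar p)) ⟨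
    ∑ (V p) (λ a → a + a ⋆) * 2       ≡⟨ cong (_* 2) (∑-chords (λ a → a)) ⟨
    ∑ R (λ a → a) * 2                 ≡⟨ ∑-range1-id M ⟩
    M * suc M                         ≡⟨ cong (λ m → m * suc m) M≡k+k ⟩
    (k + k) * suc (k + k)             ≡⟨ lem₂ k ⟩
    k * suc (k + k) * 2               ∎)
    where
    open ≡-Reasoning
    S = ∑ (V p) (λ a → a)
    a+gap : ∀ {a} → a ∈ V p → a + gap a ≡ a ⋆
    a+gap {a} a∈ = trans (cong (_+_ a) (m≤n⇒∣m-n∣≡n∸m a≤)) (m+[n∸m]≡n a≤)
      where
      a≤ : a ≤ a ⋆
      a≤ = <⇒≤ (V-<bar a∈)
    lem₁ : ∀ S → S * 3 * 2 ≡ (S + (S + S)) * 2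
    lem₁ = ℕ-Solver.solve-∀
    lem₂ : ∀ k → (k + k) * suc (k + k) ≡ k * suc (k + k) * 2
    lem₂ = ℕ-Solver.solve-∀

  -- Linear equations for the three counts.

  private
    χ : ((a A b B : ℕ) → Bool) → ℕ → ℕ → ℕ
    χ type a b = 𝟙 (type a (a ⋆) b (b ⋆))

    δ : ℕ → ℕ → ℕ
    δ a b = 𝟙 (a == b)

    #X #Y #Z S : ℕ
    #X = ∑₂ (V p) (χ crossing)
    #Y = ∑₂ (V p) (χ disjoint)
    #Z = ∑₂ (V p) (χ nested)
    S = ∑ (V p) (λ a → a)

  chord-identities : ∀ {a b} → a ∈ V p → b ∈ V p → PairIdentities a (a ⋆) b (b ⋆)
  chord-identities {a} {b} a∈ b∈ = pair-identities (V-<bar a∈) (V-<bar b∈) (cong (bar p))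
    (λ eq → trans (sym (bar-involutive (V-∈R a∈))) (trans (cong (bar p) eq) (bar-involutive (V-∈R b∈))))
    (not-upper a∈ b∈) (not-upper b∈ a∈)
    where
    -- If b̄ were in V, it would lie below its partner b, against b < b̄.
    not-upper : ∀ {a b} → a ∈ V p → b ∈ V p → a ≢ b ⋆
    not-upper {b = b} a∈ b∈ refl = <-asym (V-<bar b∈) (subst (b ⋆ <_) (bar-involutive (V-∈R b∈)) (V-<bar a∈))

  ∑₂-δ : ∑₂ (V p) δ ≡ k
  ∑₂-δ = trans (∑-cong (V p) (λ a∈ → ∑-diagonal V-unique a∈)) (∑-one (V p))

  count-pairs : k * k ≡ k + (#X + #X) + (#Y + #Y) + (#Z + #Z)
  count-pairs = begin
    k * k                            ≡⟨ cong (_* k) (∑-one (V p)) ⟨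
    ∑ (V p) (λ _ → 1) * k            ≡⟨ ∑-*ʳ (V p) (λ _ → 1) k ⟨
    ∑ (V p) (λ _ → 1 * k)            ≡⟨ ∑-cong (V p) (λ _ → trans (*-identityˡ k) (sym (∑-one (V p)))) ⟩
    ∑₂ (V p) (λ _ _ → 1)             ≡⟨ ∑₂-cong (V p) (λ a∈ b∈ → proj₁ (chord-identities a∈ b∈)) ⟩
    ∑₂ (V p) (λ a b → δ a b + (χ crossing a b + χ crossing b a)
      + (χ disjoint a b + χ disjoint b a) + (χ nested a b + χ nested b a))
      ≡⟨ ∑₂-+ (V p) _ (λ a b → χ nested a b + χ nested b a) ⟩
    _ ≡⟨ cong₂ _+_ (∑₂-+ (V p) _ (λ a b → χ disjoint a b + χ disjoint b a)) (∑₂-sym (V p) (χ nested)) ⟩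
    _ ≡⟨ cong (_+ (#Z + #Z)) (cong₂ _+_ (∑₂-+ (V p) δ (λ a b → χ crossing a b + χ crossing b a)) (∑₂-sym (V p) (χ disjoint))) ⟩
    _ ≡⟨ cong (λ z → z + (#Y + #Y) + (#Z + #Z)) (cong₂ _+_ ∑₂-δ (∑₂-sym (V p) (χ crossing))) ⟩
    k + (#X + #X) + (#Y + #Y) + (#Z + #Z) ∎
    where open ≡-Reasoning

  -- The points up to a are grouped by chord: one for the chord of a itself, one for a chord that
  -- crosses it from the left or encloses it, two for a chord entirely to its left.
  count-below : S ≡ k + #X + (#Y + #Y) + #Z
  count-below = begin
    S ≡⟨ ∑-cong (V p) (λ a∈ → sym (∑-range1-initial (∈R⇒≤M (V-∈R a∈)))) ⟩
    ∑ (V p) (λ a → ∑ R (λ y → 𝟙 (not (a <ᵇ y))))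
      ≡⟨ ∑-cong (V p) (λ {a} _ → ∑-chords (λ y → 𝟙 (not (a <ᵇ y)))) ⟩
    ∑₂ (V p) (λ a b → 𝟙 (not (a <ᵇ b)) + 𝟙 (not (a <ᵇ b ⋆)))
      ≡⟨ ∑₂-cong (V p) (λ a∈ b∈ → proj₁ (proj₂ (chord-identities a∈ b∈))) ⟩
    ∑₂ (V p) (λ a b → δ a b + χ crossing b a + (χ disjoint b a + χ disjoint b a) + χ nested b a)
      ≡⟨ ∑₂-+ (V p) _ (λ a b → χ nested b a) ⟩
    _ ≡⟨ cong₂ _+_ (∑₂-+ (V p) _ (λ a b → χ disjoint b a + χ disjoint b a)) (∑-swap (V p) (V p) (λ a b → χ nested b a)) ⟩
    _ ≡⟨ cong (_+ #Z) (cong₂ _+_ (∑₂-+ (V p) δ (λ a b → χ crossing b a))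
           (trans (∑₂-+ (V p) (λ a b → χ disjoint b a) (λ a b → χ disjoint b a)) (cong₂ _+_ #Yᵒ #Yᵒ))) ⟩
    _ ≡⟨ cong (λ z → z + (#Y + #Y) + #Z) (cong₂ _+_ ∑₂-δ (∑-swap (V p) (V p) (λ a b → χ crossing b a))) ⟩
    k + #X + (#Y + #Y) + #Z ∎
    where
    open ≡-Reasoning
    #Yᵒ : ∑₂ (V p) (λ a b → χ disjoint b a) ≡ #Y
    #Yᵒ = ∑-swap (V p) (V p) (λ a b → χ disjoint b a)

  -- The reversals counted by `inversions` are sorted by the chords of their two points. A chord has
  -- one with itself, and an ordered pair of distinct chords has one if they cross, two if they are
  -- nested and none if they are disjoint.
  count-inversions : k * k ≡ k + (#X + #X) + ((#Z + #Z) + (#Z + #Z))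
  count-inversions = begin
    k * k ≡⟨ inversions ⟨
    ∑ R (λ x → ∑ R (F x)) ≡⟨ ∑-chords (λ x → ∑ R (F x)) ⟩
    ∑ (V p) (λ a → ∑ R (F a) + ∑ R (F (a ⋆)))
      ≡⟨ ∑-cong (V p) (λ {a} _ → trans (cong₂ _+_ (∑-chords (F a)) (∑-chords (F (a ⋆))))
           (sym (∑-+ (V p) (λ b → F a b + F a (b ⋆)) (λ b → F (a ⋆) b + F (a ⋆) (b ⋆))))) ⟩
    ∑₂ (V p) (λ a b → (F a b + F a (b ⋆)) + (F (a ⋆) b + F (a ⋆) (b ⋆)))
      ≡⟨ ∑₂-cong (V p) (λ a∈ b∈ → trans (unbar a∈ b∈) (proj₂ (proj₂ (chord-identities a∈ b∈)))) ⟩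
    ∑₂ (V p) (λ a b → δ a b + (χ crossing a b + χ crossing b a)
      + ((χ nested a b + χ nested b a) + (χ nested a b + χ nested b a)))
      ≡⟨ ∑₂-+ (V p) _ (λ a b → (χ nested a b + χ nested b a) + (χ nested a b + χ nested b a)) ⟩
    _ ≡⟨ cong₂ _+_ (∑₂-+ (V p) δ (λ a b → χ crossing a b + χ crossing b a))
           (∑₂-+ (V p) (λ a b → χ nested a b + χ nested b a) (λ a b → χ nested a b + χ nested b a)) ⟩
    _ ≡⟨ cong₂ _+_ (cong₂ _+_ ∑₂-δ (∑₂-sym (V p) (χ crossing)))
           (cong₂ _+_ (∑₂-sym (V p) (χ nested)) (∑₂-sym (V p) (χ nested))) ⟩
    k + (#X + #X) + ((#Z + #Z) + (#Z + #Z)) ∎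
    where
    open ≡-Reasoning
    F : ℕ → ℕ → ℕ
    F x y = inversion x (x ⋆) y (y ⋆)
    -- The images of ā and b̄ under `bar` are a and b again; this brings the four terms into the
    -- form of the third identity.
    unbar : ∀ {a b} → a ∈ V p → b ∈ V p →
      (F a b + F a (b ⋆)) + (F (a ⋆) b + F (a ⋆) (b ⋆))
        ≡ (inversion a (a ⋆) b (b ⋆) + inversion a (a ⋆) (b ⋆) b)
          + (inversion (a ⋆) a b (b ⋆) + inversion (a ⋆) a (b ⋆) b)
    unbar {a} {b} a∈ b∈ = cong₂
      (λ a′ b′ → (F a b + inversion a (a ⋆) (b ⋆) b′) + (inversion (a ⋆) a′ b (b ⋆) + inversion (a ⋆) a′ (b ⋆) b′))
      (bar-involutive (V-∈R a∈)) (bar-involutive (V-∈R b∈))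

  -- The two expressions for k² differ only in 2|Y| against 2|Z|.
  #Y≡#Z : #Y ≡ #Z
  #Y≡#Z = +-double-injective (+-cancelʳ-≡ (#Z + #Z) (#Y + #Y) (#Z + #Z)
    (+-cancelˡ-≡ (k + (#X + #X)) _ _ (begin
      k + (#X + #X) + ((#Y + #Y) + (#Z + #Z)) ≡⟨ +-assoc (k + (#X + #X)) (#Y + #Y) (#Z + #Z) ⟨
      k + (#X + #X) + (#Y + #Y) + (#Z + #Z)   ≡⟨ count-pairs ⟨
      k * k                                   ≡⟨ count-inversions ⟩
      k + (#X + #X) + ((#Z + #Z) + (#Z + #Z)) ∎)))
    where open ≡-Reasoning

  -- Evaluate 3S twice: as k(2k + 1) = k + 2k² with k² from `count-inversions`, and as three times
  -- `count-below` with |Y| = |Z|. The cancelled term 3k + 3|X| + 8|Z| is the common part.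
  #X≡#Z : #X ≡ #Z
  #X≡#Z = +-cancelˡ-≡ (3 * k + 3 * #X + 8 * #Z) #X #Z (begin
    3 * k + 3 * #X + 8 * #Z + #X                     ≡⟨ lem₁ k #X #Z ⟩
    k + 2 * (k + (#X + #X) + ((#Z + #Z) + (#Z + #Z))) ≡⟨ cong (λ z → k + 2 * z) count-inversions ⟨
    k + 2 * (k * k)                                  ≡⟨ lem₂ k ⟩
    k * suc (k + k)                                  ≡⟨ 3*∑V ⟨
    S * 3                                            ≡⟨ cong (_* 3) (trans count-below (cong (λ y → k + #X + (y + y) + #Z) #Y≡#Z)) ⟩
    (k + #X + (#Z + #Z) + #Z) * 3                    ≡⟨ lem₃ k #X #Z ⟩
    3 * k + 3 * #X + 8 * #Z + #Z                     ∎)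
    where
    open ≡-Reasoning
    lem₁ : ∀ k x z → 3 * k + 3 * x + 8 * z + x ≡ k + 2 * (k + (x + x) + ((z + z) + (z + z)))
    lem₁ = ℕ-Solver.solve-∀
    lem₂ : ∀ k → k + 2 * (k * k) ≡ k * suc (k + k)
    lem₂ = ℕ-Solver.solve-∀
    lem₃ : ∀ k x z → (k + x + (z + z) + z) * 3 ≡ 3 * k + 3 * x + 8 * z + z
    lem₃ = ℕ-Solver.solve-∀

  k*k≡k+6*#Z : k * k ≡ k + 6 * #Z
  k*k≡k+6*#Z = trans count-inversions (trans (cong (λ x → k + (x + x) + ((#Z + #Z) + (#Z + #Z))) #X≡#Z) (lem k #Z))
    where
    lem : ∀ k z → k + (z + z) + ((z + z) + (z + z)) ≡ k + 6 * z
    lem = ℕ-Solver.solve-∀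

  -- As p = 4k + 1, the product is 16k(k - 1), and k(k - 1) = 6|Z|. In particular the division by 96
  -- is exact.
  [p∸1][p∸5]≡ : (p ∸ 1) * (p ∸ 5) ≡ #Z * 96
  [p∸1][p∸5]≡ = trans (cong (λ q → (q ∸ 1) * (q ∸ 5)) (trans p≡ (cong (λ m → suc (m + m)) M≡k+k))) (go k #Z k*k≡k+6*#Z)
    where
    go : ∀ k z → k * k ≡ k + 6 * z → (k + k + (k + k)) * (k + k + (k + k) ∸ 4) ≡ z * 96
    -- The case k = 0 is separate because the truncated subtraction of 4 from 4k is faithful only
    -- for k ≥ 1.
    go zero    zero eq = refl
    go (suc j) z    eq = begin
      (suc j + suc j + (suc j + suc j)) * (suc j + suc j + (suc j + suc j) ∸ 4)
        ≡⟨ cong (λ q → (suc j + suc j + (suc j + suc j)) * (q ∸ 4)) (lem₁ j) ⟩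
      (suc j + suc j + (suc j + suc j)) * (4 * j)  ≡⟨ lem₂ j ⟩
      16 * (j * suc j)                             ≡⟨ cong (16 *_) (+-cancelˡ-≡ (suc j) (j * suc j) (6 * z) eq) ⟩
      16 * (6 * z)                                 ≡⟨ lem₃ z ⟩
      z * 96                                       ∎
      where
      open ≡-Reasoning
      lem₁ : ∀ j → suc j + suc j + (suc j + suc j) ≡ 4 + 4 * j
      lem₁ = ℕ-Solver.solve-∀
      lem₂ : ∀ j → (suc j + suc j + (suc j + suc j)) * (4 * j) ≡ 16 * (j * suc j)
      lem₂ = ℕ-Solver.solve-∀
      lem₃ : ∀ z → 16 * (6 * z) ≡ z * 96
      lem₃ = ℕ-Solver.solve-∀

  #Z≡ : #Z ≡ ((p ∸ 1) * (p ∸ 5)) / 96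
  #Z≡ = sym (trans (cong (_/ 96) [p∸1][p∸5]≡) (m*n/n≡m #Z 96))

  counts : (length (X p) ≡ ((p ∸ 1) * (p ∸ 5)) / 96)
    × (length (Y p) ≡ ((p ∸ 1) * (p ∸ 5)) / 96)
    × (length (Z p) ≡ ((p ∸ 1) * (p ∸ 5)) / 96)
  -- The decision procedures in `X`, `Y` and `Z` reduce to `crossing`, `disjoint` and `nested`, so
  -- the sums from `length-filter-pairs` are `#X`, `#Y` and `#Z` by definition.
  counts = trans (length-filter-pairs _ (V p) (V p)) (trans #X≡#Z #Z≡)
    , trans (length-filter-pairs _ (V p) (V p)) (trans #Y≡#Z #Z≡)
    , trans (length-filter-pairs _ (V p) (V p)) #Z≡

-- Reduction to p = 4k + 1.

theorem3p5 : (p : ℕ) → .{{_ : NonZero p}} → Prime p → p % 4 ≡ 1 →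
    (length (X p) ≡ ((p ∸ 1) * (p ∸ 5)) / 96)
    × (length (Y p) ≡ ((p ∸ 1) * (p ∸ 5)) / 96)
    × (length (Z p) ≡ ((p ∸ 1) * (p ∸ 5)) / 96)
theorem3p5 p pr p%4≡1 = go (p / 4) (trans (m≡m%n+[m/n]*n p 4) (cong₂ _+_ p%4≡1 (lem (p / 4)))) pr
  where
  lem : ∀ k → k * 4 ≡ (k + k) + (k + k)
  lem = ℕ-Solver.solve-∀
  -- Generalising p allows the equation p = 4k + 1 to be matched with `refl`.
  go : ∀ k {p} .{{_ : NonZero p}} → p ≡ suc ((k + k) + (k + k)) → Prime p →
    (length (X p) ≡ ((p ∸ 1) * (p ∸ 5)) / 96)
    × (length (Y p) ≡ ((p ∸ 1) * (p ∸ 5)) / 96)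
    × (length (Z p) ≡ ((p ∸ 1) * (p ∸ 5)) / 96)
  go zero    refl pr = ⊥-elim (¬prime[1] pr)
  go k@(suc _) {p} refl pr = Chords.counts p (cong (λ m → suc (m + m)) (sym half≡))
    (subst (λ m → Congruence._≈_ p (+ product (range1 m) ℤ.* + product (range1 m)) -1ℤ)
      (sym half≡) (HalfFactorial.half!²≈-1 k pr (s≤s z≤n)))
    where
    half≡ : half p ≡ k + k
    half≡ = trans (cong (_/ 2) (sym (trans (*-comm (k + k) 2) (cong (_+_ (k + k)) (+-identityʳ (k + k)))))) (m*n/n≡m (k + k) 2)
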